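{- Let $A$ be a set of actions. The proof systems $\mathsf{Mil}$, $\mathsf{cMil}_1$, $\mathsf{cMil}$ and $\mathsf{CLC}$ over $A$ are theorem-equivalent: for all star expressions $e,f$ over $A$, the formal equation $e=f$ is derivable (without assumptions) in one of these four systems if and only if it is derivable in each of the others.
   Context: **Star expressions and equational systems.** Star expressions over $A$, forming the set $StExp(A)$, are given by $e ::= 0 \mid 1 \mid a \mid (e_1+e_2)\mid (e_1\cdot e_2)\mid (e^*)$ with $a\in A$. $\equiv$ is syntactic equality. $Eq(A)$ is the set of formal equations $e=f$ with $e,f\in StExp(A)$. Immediate termination $e{\downarrow}$ is defined inductively: $1{\downarrow}$; $(e_1+e_2){\downarrow}$ if $e_1{\downarrow}$ or $e_2{\downarrow}$; $(e_1\cdot e_2){\downarrow}$ if $e_1{\downarrow}$ and $e_2{\downarrow}$; $(e^*){\downarrow}$ always. Finite sums $\sum_{i=1}^n e_i$ denote $0$ if $n=0$, $e_1$ if $n=1$, and $(\sum_{i=1}^{n-1}e_i)+e_n$ if $n>1$. An $\mathcal{EL}$-based system over $StExp(A)$ is a proof system whose formulas are the equations in $Eq(A)$ and whose rules include those of equational logic (reflexivity, symmetry, transitivity, closure under one-hole star expression contexts); it may have further axioms and rules. $e=_{\mathcal S}f$ means that $e=f$ is derivable in $\mathcal S$ without assumptions. $\mathsf{Mil}^-$ is the $\mathcal{EL}$-based system with only the rules of equational logic and the axiom schemes: $(e+f)+g=e+(f+g)$; $e+0=e$; $e+f=f+e$; $e+e=e$; $(e\cdot f)\cdot g=e\cdot(f\cdot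 g)$; $(e+f)\cdot g=e\cdot g+f\cdot g$; $1\cdot e=e$; $e\cdot 1=e$; $0\cdot e=0$; $e^*=1+e\cdot e^*$; $e^*=(1+e)^*$. For $\Gamma\subseteq Eq(A)$, $\mathsf{Mil}^-+\Gamma$ is $\mathsf{Mil}^-$ with the equations in $\Gamma$ added as axioms. Milner's system $\mathsf{Mil}$ is $\mathsf{Mil}^-$ plus the rule $\mathrm{RSP}^*$: from $e=f\cdot e+g$ infer $e=f^*\cdot g$, provided that $f{\downarrow}$ does not hold. **1-charts and LLEE.** A 1-chart is a tuple $\underline{C}=\langle V,A,1,v_s,\to,{\downarrow}\rangle$ with $V$ a finite set of vertices, $1\notin A$ the empty-step label, $v_s\in V$ the start vertex, ${\to}\subseteq V\times(A\cup\{1\})\times V$ a (finite) labeled transition relation, and ${\downarrow}\subseteq V$ the set of vertices with immediate termination. Transitions labeled in $A$ are proper; those labeled $1$ are 1-transitions. It is weakly guarded if it has no cycle of 1-transitions. A loop 1-chart is a 1-chart such that (L1) there is an infinite path from its start vertex, (L2) every infinite path from the start vertex returns to it after a positive number of transitions, (L3) only the start vertex may have immediate termination. For a vertex $v$ of $\underline C$ and a nonempty set $U$ of transitions from $v$, consider the sub-1-chart with start vertex $v$ consisting of all vertices and transitions on paths that start with a transition in $U$ and continue until $v$ is reached again (termination inherited from $\underline C$). If it is a loop 1-chart it is called a loop sub-1-chart of $\underline C$, with loop-entry transitions $U$; its remaining transitions are its loop-body transitions. Eliminating it from $\underline C$ means removing the transitions in $U$ and then all vertices and transitions that become unreachable from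 the start vertex. $\underline C$ is an LLEE-1-chart if there is a finite sequence $\underline C=\underline C_0,\dots,\underline C_n$ where $\underline C_i$ results from $\underline C_{i-1}$ by eliminating a loop sub-1-chart $L_i$ of $\underline{C}_{i-1}$ with loop-entry transitions $U_i$, $\underline C_n$ has no infinite path, and for $i<j$ no transition in $U_j$ is a loop-body transition of $L_i$ (layeredness). **Coinductive proofs.** Let $\mathcal S$ be an $\mathcal{EL}$-based system containing the axioms for associativity, commutativity and idempotency of $+$. A function $s:V\to StExp(A)$ is an $\mathcal S$-provable solution of $\underline C$ if for every $v\in V$, with $\{v\xrightarrow{\underline a_i}v_i\mid 1\le i\le n\}$ a list of all transitions from $v$, it holds that $s(v)=_{\mathcal S}\tau(v)+\sum_{i=1}^n\underline a_i\cdot s(v_i)$, where $\tau(v)\equiv 1$ if $v\in{\downarrow}$ and $\tau(v)\equiv 0$ otherwise (the label $1$ being read as the star expression $1$). A coinductive proof over $\mathcal S$ of $e_1=e_2$ is a pair $\langle\underline C,L\rangle$ with $\underline C$ a weakly guarded 1-chart and $L:V\to Eq(A)$, $L(v)=(L_1(v)=L_2(v))$, such that $L_1$ and $L_2$ are $\mathcal S$-provable solutions of $\underline C$, and $e_1\equiv L_1(v_s)$, $e_2\equiv L_2(v_s)$. It is LLEE-witnessed if $\underline C$ is an LLEE-1-chart. **Systems.** For $n\in\mathbb N$ (including $0$), the rule $\mathrm{LCoProof}_n$ has premises $g_1=h_1,\dots,g_n=h_n$ together with, as $(n+1)$-th premise, an LLEE-witnessed coinductive proof of $e=f$ over $\mathsf{Mil}^-+\{g_1=h_1,\dots,g_n=h_n\}$,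 and has conclusion $e=f$. (The coinductive-proof premise is a given object that needs no further derivation.) $\mathsf{CLC}$ has only the rules $\mathrm{LCoProof}_n$, $n\in\mathbb N$ (no axioms, no rules of equational logic). $\mathsf{cMil}$ has the axioms of $\mathsf{Mil}^-$, the rules of equational logic, and all rules $\mathrm{LCoProof}_n$, $n\in\mathbb N$. $\mathsf{cMil}_1$ has the axioms of $\mathsf{Mil}^-$, the rules of equational logic, and only the rule $\mathrm{LCoProof}_1$. -}

module Defs where

open import Data.Bool.Base using (Bool; T; if_then_else_)
open import Data.Fin.Base using (Fin)
open import Data.List.Base using (List; []; _∷_; map; foldl; length)
open import Data.List.Membership.Propositional using (_∈_)
open import Data.List.Relation.Unary.All using (All)
open import Data.List.Relation.Unary.Unique.Propositional using (Unique)
open import Data.Maybe.Base using (Maybe; just; nothing)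
open import Data.Nat.Base using (ℕ; zero; suc)
open import Data.Product.Base using (Σ-syntax; ∃-syntax; _×_; _,_)
open import Data.Sum.Base using (_⊎_; inj₁; inj₂)
open import Data.Unit.Polymorphic.Base using (⊤)
open import Function.Bundles using (_⇔_; _↔_)
open import Level using (Level; _⊔_) renaming (zero to 0ℓ; suc to lsuc)
open import Relation.Binary.Construct.Closure.ReflexiveTransitive using (Star; ε; _◅_; _◅◅_)
open import Relation.Binary.Construct.Closure.Transitive using (TransClosure)
open import Relation.Binary.Construct.Union using (_∪_)
open import Relation.Binary.Core using (REL)
open import Relation.Binary.PropositionalEquality.Core using (_≡_; _≢_)
open import Relation.Nullary.Negation.Core using (¬_)
open import Relation.Unary using (Pred)

private
  variable
    a ℓ ℓ′ : Level
    A : Set a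

infixl 6 _+_
infixl 7 _·_
infix  8 _*

data StExp (A : Set a) : Set a where
  𝟎 𝟏     : StExp A
  act     : A → StExp A
  _+_ _·_ : StExp A → StExp A → StExp A
  _*      : StExp A → StExp A

infix 5 _↓

data _↓ {A : Set a} : StExp A → Set a where
  𝟏↓  : 𝟏 ↓
  +↓₁ : ∀ {e₁ e₂} → e₁ ↓ → (e₁ + e₂) ↓
  +↓₂ : ∀ {e₁ e₂} → e₂ ↓ → (e₁ + e₂) ↓
  ·↓  : ∀ {e₁ e₂} → e₁ ↓ → e₂ ↓ → (e₁ · e₂) ↓
  *↓  : ∀ {e} → (e *) ↓

∑ : List (StExp A) → StExp A
∑ []       = 𝟎
∑ (e ∷ es) = foldl _+_ e es

-- One-hole contexts.
data Ctx (A : Set a) : Set a where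
  □         : Ctx A
  _+ˡ_ _·ˡ_ : Ctx A → StExp A → Ctx A
  _+ʳ_ _·ʳ_ : StExp A → Ctx A → Ctx A
  _*ᶜ       : Ctx A → Ctx A

_[_] : Ctx A → StExp A → StExp A
□        [ e ] = e
(C +ˡ f) [ e ] = C [ e ] + f
(C ·ˡ f) [ e ] = C [ e ] · f
(f +ʳ C) [ e ] = f + C [ e ]
(f ·ʳ C) [ e ] = f · C [ e ]
(C *ᶜ)   [ e ] = (C [ e ]) *

infix 4 _≐_

record Eq (A : Set a) : Set a where
  constructor _≐_
  field
    lhs rhs : StExp A

open Eq public

-- A proof system is identified with its set of rule instances: a relation
-- between lists of premises and conclusions.  Axioms are rules without
-- premises.
System : Set a → (ℓ : Level) → Set (a ⊔ lsuc ℓ)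
System A ℓ = REL (List (Eq A)) (Eq A) ℓ

infix 3 _⊢_

data _⊢_ {A : Set a} (S : System A ℓ) : Eq A → Set (a ⊔ ℓ) where
  by : ∀ {premises conclusion} → S premises conclusion →
       All (S ⊢_) premises → S ⊢ conclusion

data Axioms {A : Set a} (P : Pred (Eq A) ℓ) : System A (a ⊔ ℓ) where
  axiom : ∀ {q} → P q → Axioms P [] q

data EL (A : Set a) : System A a where
  reflexivity  : ∀ {e} → EL A [] (e ≐ e)
  symmetry     : ∀ {e f} → EL A ((e ≐ f) ∷ []) (f ≐ e)
  transitivity : ∀ {e f g} → EL A ((e ≐ f) ∷ (f ≐ g) ∷ []) (e ≐ g)
  context      : ∀ {e f} (C : Ctx A) → EL A ((e ≐ f) ∷ []) (C [ e ] ≐ C [ f ])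

data Mil⁻Axiom {A : Set a} : Pred (Eq A) a where
  +-assoc   : ∀ {e f g} → Mil⁻Axiom ((e + f) + g ≐ e + (f + g))
  +-𝟎       : ∀ {e}     → Mil⁻Axiom (e + 𝟎 ≐ e)
  +-comm    : ∀ {e f}   → Mil⁻Axiom (e + f ≐ f + e)
  +-idem    : ∀ {e}     → Mil⁻Axiom (e + e ≐ e)
  ·-assoc   : ∀ {e f g} → Mil⁻Axiom ((e · f) · g ≐ e · (f · g))
  ·-distʳ-+ : ∀ {e f g} → Mil⁻Axiom ((e + f) · g ≐ e · g + f · g)
  𝟏-·       : ∀ {e}     → Mil⁻Axiom (𝟏 · e ≐ e)
  ·-𝟏       : ∀ {e}     → Mil⁻Axiom (e · 𝟏 ≐ e)
  𝟎-·       : ∀ {e}     → Mil⁻Axiom (𝟎 · e ≐ 𝟎)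
  *-unfold  : ∀ {e}     → Mil⁻Axiom (e * ≐ 𝟏 + e · e *)
  *-𝟏+      : ∀ {e}     → Mil⁻Axiom (e * ≐ (𝟏 + e) *)

data RSP* (A : Set a) : System A a where
  rsp* : ∀ {e f g} → ¬ (f ↓) → RSP* A ((e ≐ f · e + g) ∷ []) (e ≐ f * · g)

Mil⁻ : (A : Set a) → System A a
Mil⁻ A = EL A ∪ Axioms Mil⁻Axiom

Mil⁻+ : {A : Set a} → Pred (Eq A) ℓ → System A (a ⊔ ℓ)
Mil⁻+ {A = A} Γ = Mil⁻ A ∪ Axioms Γ

Mil : (A : Set a) → System A a
Mil A = Mil⁻ A ∪ RSP* A

-- 'just x' is the proper label x, 'nothing' is the empty-step label 1.
Label : Set a → Set a
Label = Maybe

⌜_⌝ : Label A → StExp A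
⌜ just x ⌝  = act x
⌜ nothing ⌝ = 𝟏

-- The transition relation is given by listing, for each vertex, its outgoing
-- transitions without repetition; this way no decidable equality on A is
-- needed.
record OneChart (A : Set a) : Set (lsuc 0ℓ ⊔ a) where
  field
    V          : Set
    V-finite   : ∃[ n ] (V ↔ Fin n)
    start      : V
    out        : V → List (Label A × V)
    out-unique : ∀ v → Unique (out v)
    terminates : V → Bool

module _ {A : Set a} (C : OneChart A) where
  open OneChart C

  WeaklyGuarded : Set a
  WeaklyGuarded = ∀ v → ¬ TransClosure (λ x y → (nothing , y) ∈ out x) v v

  -- A sub-1-chart; it inherits termination from C.
  record SubChart : Set (lsuc a) where
    field
      root     : V
      Vertex   : V → Set a
      Step     : V → Label A → V → Set a
      root∈    : Vertex root
      source∈  : ∀ {v l w} → Step v l w → Vertex v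
      target∈  : ∀ {v l w} → Step v l w → Vertex w
      Step⊆out : ∀ {v l w} → Step v l w → (l , w) ∈ out v

  whole : SubChart
  whole = record
    { root     = start
    ; Vertex   = λ _ → ⊤
    ; Step     = λ v l w → (l , w) ∈ out v
    ; root∈    = _
    ; source∈  = _
    ; target∈  = _
    ; Step⊆out = λ s → s
    }

  module _ (S : SubChart) where
    open SubChart S

    record InfinitePath (v : V) : Set a where
      field
        vertex : ℕ → V
        label  : ℕ → Label A
        begins : vertex zero ≡ v
        step   : ∀ i → Step (vertex i) (label i) (vertex (suc i))

    record IsLoop : Set a where
      field
        L1 : InfinitePath root
        L2 : (p : InfinitePath root) → ∃[ i ] InfinitePath.vertex p (suc i) ≡ root
        L3 : ∀ {v} → Vertex v → T (terminates v) → v ≡ root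

    -- U lists the labels and targets of a nonempty set of transitions from v.
    record Entries : Set a where
      field
        v          : V
        U          : List (Label A × V)
        U-nonempty : U ≢ []
        U⊆Step     : ∀ {l w} → (l , w) ∈ U → Step v l w

    module _ (E : Entries) where
      open Entries E

      -- Vertices and transitions on paths that start with a transition in U
      -- and continue until v is reached again.
      data LoopVertex : V → Set a
      data EntryStep : V → Label A → V → Set a
      data BodyStep : V → Label A → V → Set a

      data LoopVertex where
        at-v        : LoopVertex v
        after-entry : ∀ {x l y} → EntryStep x l y → LoopVertex y
        after-body  : ∀ {x l y} → BodyStep x l y → LoopVertex y

      data EntryStep where
        entry : ∀ {l w} → (l , w) ∈ U → EntryStep v l w

      data BodyStep where
        body : ∀ {x l y} → LoopVertex x → x ≢ v → Step x l y → BodyStep x l y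

      loopSubChart : SubChart
      loopSubChart = record
        { root     = v
        ; Vertex   = LoopVertex
        ; Step     = λ x l y → EntryStep x l y ⊎ BodyStep x l y
        ; root∈    = at-v
        ; source∈  = λ { (inj₁ (entry _))    → at-v
                       ; (inj₂ (body x∈ _ _)) → x∈ }
        ; target∈  = λ { (inj₁ s) → after-entry s
                       ; (inj₂ s) → after-body s }
        ; Step⊆out = λ { (inj₁ (entry u))   → Step⊆out (U⊆Step u)
                       ; (inj₂ (body _ _ s)) → Step⊆out s }
        }

      Remaining : V → Label A → V → Set a
      Remaining x l y = Step x l y × ¬ EntryStep x l y

      Reachable : V → Set a
      Reachable = Star (λ x y → ∃[ l ] Remaining x l y) root

      eliminate : SubChart
      eliminate = record
        { root     = root
        ; Vertex   = Reachable
        ; Step     = λ x l y → Reachable x × Remaining x l y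
        ; root∈    = ε
        ; source∈  = λ (r , _) → r
        ; target∈  = λ (r , s) → r ◅◅ ((_ , s) ◅ ε)
        ; Step⊆out = λ (_ , s , _) → Step⊆out s
        }

  -- Finite sequences of loop eliminations from S that end in a sub-1-chart
  -- without infinite paths.
  data Elimination (S : SubChart) : Set a where
    stop : (∀ v → ¬ InfinitePath S v) → Elimination S
    elim : (E : Entries S) → IsLoop (loopSubChart S E) →
           Elimination (eliminate S E) → Elimination S

  -- No loop-entry transition used in the sequence belongs to B.
  EntriesAvoid : (B : V → Label A → V → Set a) {S : SubChart} → Elimination S → Set a
  EntriesAvoid B     (stop _)       = ⊤
  EntriesAvoid B {S} (elim E _ seq) =
    (∀ {x l y} → EntryStep S E x l y → ¬ B x l y) × EntriesAvoid B seq

  Layered : {S : SubChart} → Elimination S → Set a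
  Layered     (stop _)       = ⊤
  Layered {S} (elim E _ seq) = EntriesAvoid (BodyStep S E) seq × Layered seq

  LLEE : Set a
  LLEE = Σ[ seq ∈ Elimination whole ] Layered seq

module _ {A : Set a} (C : OneChart A) where
  open OneChart C

  τ : V → StExp A
  τ v = if terminates v then 𝟏 else 𝟎

  -- Meant for systems S with equational logic and associativity, commutativity
  -- and idempotency of +, where the order of 'out v' is immaterial; it is used
  -- only for extensions of Mil⁻.
  IsSolution : System A ℓ → (V → StExp A) → Set (a ⊔ ℓ)
  IsSolution S s =
    ∀ v → S ⊢ s v ≐ τ v + ∑ (map (λ (l , w) → ⌜ l ⌝ · s w) (out v))

record CoinductiveProof {A : Set a} (S : System A ℓ) (q : Eq A) : Set (lsuc 0ℓ ⊔ a ⊔ ℓ) where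
  field
    chart         : OneChart A
    weaklyGuarded : WeaklyGuarded chart

  open OneChart chart

  field
    L         : V → Eq A
    solution₁ : IsSolution chart S (λ v → lhs (L v))
    solution₂ : IsSolution chart S (λ v → rhs (L v))
    lhs≡      : lhs q ≡ lhs (L start)
    rhs≡      : rhs q ≡ rhs (L start)

LLEEWitnessed : {A : Set a} {S : System A ℓ} {q : Eq A} → CoinductiveProof S q → Set a
LLEEWitnessed P = LLEE (CoinductiveProof.chart P)

-- The coinductive-proof premise is part of the rule instance, since it needs
-- no further derivation.
LCoProof : (A : Set a) → ℕ → System A (lsuc 0ℓ ⊔ a)
LCoProof A n Γ q =
  length Γ ≡ n × (Σ[ P ∈ CoinductiveProof (Mil⁻+ (_∈ Γ)) q ] LLEEWitnessed P)

CLC : (A : Set a) → System A (lsuc 0ℓ ⊔ a)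
CLC A Γ q = ∃[ n ] LCoProof A n Γ q

cMil : (A : Set a) → System A (lsuc 0ℓ ⊔ a)
cMil A = Mil⁻ A ∪ CLC A

cMil₁ : (A : Set a) → System A (lsuc 0ℓ ⊔ a)
cMil₁ A = Mil⁻ A ∪ LCoProof A 1

TheoremEquivalent : {A : Set a} → System A ℓ → System A ℓ′ → Set (a ⊔ ℓ ⊔ ℓ′)
TheoremEquivalent S S′ = ∀ e f → (S ⊢ e ≐ f) ⇔ (S′ ⊢ e ≐ f)

{-# OPTIONS --safe #-}
-- From LCoProof to Mil: two solutions of a weakly guarded LLEE-1-chart agree at
-- the start vertex.  Along an elimination sequence one keeps, for each vertex
-- w, an equation s w = P · s w + (τ w + ∑ of the remaining transitions) with P
-- not immediately terminating and the same for both solutions.  When a loop at v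
-- is eliminated, RSP* applied to its other vertices gives s w = t · s v, and the
-- entry transitions are absorbed into P at v; a termination of the absorbed part
-- would yield a cycle of 1-transitions.  In the end no infinite path is left, and
-- RSP* yields a common value.  Layeredness plays no role in this direction.
--
-- From Mil to LCoProof: every expression is provably equal to one in which the
-- bodies of stars do not terminate immediately.  Its Thompson-style chart, with
-- 1-transitions between the parts, is a weakly guarded LLEE-1-chart whose loops
-- are the stars.  Overriding the solution at the start vertex proves any derivable
-- equation, and for RSP* one overrides the star vertex of the chart of f* · g
-- by an arbitrary X with X = f · X + g.
module Submission where

open import Defs
open import Level as Level using (Level; _⊔_)
open import Algebra.Bundles using (CommutativeMonoid)
import Algebra.Properties.CommutativeSemigroup as CommutativeSemigroupProperties
open import Data.Bool.Base using (Bool; true; false; T; if_then_else_)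
open import Data.Empty using (⊥)
open import Data.Fin.Base using (Fin)
open import Data.Fin.Induction using (spo-wellFounded)
open import Data.Fin.Properties using (inj⇒≟; 1↔⊤; +↔⊎)
open import Data.List.Base using (List; []; _∷_; _++_; map; foldl; foldr)
open import Data.List.Membership.Propositional using (_∈_)
open import Data.List.Membership.Propositional.Properties using (∈-++⁺ˡ; ∈-++⁺ʳ; ∈-++⁻; ∈-map⁺)
open import Data.List.Relation.Unary.All as All using (All; []; _∷_)
import Data.List.Relation.Unary.All.Properties as All
open import Data.List.Relation.Unary.AllPairs using (AllPairs; []; _∷_)
import Data.List.Relation.Unary.AllPairs.Properties as AllPairs
open import Data.List.Relation.Unary.Any using (here; there)
open import Data.List.Relation.Unary.Unique.Propositional using (Unique)
open import Data.Maybe.Base using (just; nothing)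
open import Data.Nat.Base as ℕ using (ℕ; zero; suc; _<_; s≤s)
import Data.Nat.Properties as ℕ
open import Data.Product.Base as Product using (Σ-syntax; ∃-syntax; _×_; _,_; proj₁; proj₂)
open import Data.Sum.Base as Sum using (_⊎_; inj₁; inj₂)
open import Data.Sum.Function.Propositional using (_⊎-↔_)
open import Data.Sum.Properties using (inj₁-injective; inj₂-injective)
open import Data.Unit.Base using (⊤; tt)
open import Data.Unit.Polymorphic.Base using () renaming (⊤ to ⊤ₚ)
open import Function.Base using (id; _∘_; flip; case_of_)
open import Function.Bundles using (_↔_; mk⇔; Inverse)
open import Function.Construct.Composition using (_↔-∘_)
open import Function.Construct.Symmetry using (↔-sym)
open import Function.Properties.Inverse using (Inverse⇒Injection)
open import Induction.WellFounded using (WellFounded; Acc; acc; module Subrelation)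
open import Relation.Binary.Construct.Closure.ReflexiveTransitive using (Star; ε; _◅_; _◅◅_)
open import Relation.Binary.Construct.Closure.Transitive using (TransClosure; _∷_)
  renaming ([_] to [_]⁺; _++_ to _++⁺_)
import Relation.Binary.Construct.On as On
open import Relation.Binary.Core using (Rel)
open import Relation.Binary.Definitions using (DecidableEquality)
open import Relation.Binary.PropositionalEquality
  using (_≡_; _≢_; refl; sym; cong; cong₂; subst; subst₂; isEquivalence)
import Relation.Binary.Reasoning.Setoid as SetoidReasoning
open import Relation.Binary.Structures using (IsStrictPartialOrder)
open import Relation.Nullary.Decidable.Core using (Dec; yes; no; map′; does; _⊎-dec_; _×-dec_)
open import Relation.Nullary.Negation.Core using (¬_; contradiction)
open import Relation.Unary using (Pred)

private
  variable
    a ℓ ℓ′ : Level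
    A : Set a
    S : System A ℓ
    S′ : System A ℓ′
    W : Set

-- Derivations and equational reasoning

module _ (rule : ∀ {Γ q} → S Γ q → All (S′ ⊢_) Γ → S′ ⊢ q) where
  translate    : ∀ {q} → S ⊢ q → S′ ⊢ q
  translateAll : ∀ {Γ} → All (S ⊢_) Γ → All (S′ ⊢_) Γ
  translate (by r ps)   = rule r (translateAll ps)
  translateAll []       = []
  translateAll (p ∷ ps) = translate p ∷ translateAll ps

summands : {V : Set} → (V → StExp A) → List (Label A × V) → List (StExp A)
summands s = map λ (l , w) → ⌜ l ⌝ · s w

module Equational {a ℓ} {A : Set a} {S : System A ℓ}
  (mil⁻ : ∀ {Γ q} → Mil⁻ A Γ q → S Γ q) where

  infix 4 _≈_

  _≈_ : StExp A → StExp A → Set (a ⊔ ℓ)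
  e ≈ f = S ⊢ e ≐ f

  ax : ∀ {e f} → Mil⁻Axiom (e ≐ f) → e ≈ f
  ax p = by (mil⁻ (inj₂ (axiom p))) []

  ≈-refl : ∀ {e} → e ≈ e
  ≈-refl = by (mil⁻ (inj₁ reflexivity)) []

  ≈-sym : ∀ {e f} → e ≈ f → f ≈ e
  ≈-sym p = by (mil⁻ (inj₁ symmetry)) (p ∷ [])

  ≈-trans : ∀ {e f g} → e ≈ f → f ≈ g → e ≈ g
  ≈-trans p q = by (mil⁻ (inj₁ transitivity)) (p ∷ q ∷ [])

  plug : ∀ C {e f} → e ≈ f → C [ e ] ≈ C [ f ]
  plug C p = by (mil⁻ (inj₁ (context C))) (p ∷ [])

  +-cong : ∀ {e e′ f f′} → e ≈ e′ → f ≈ f′ → e + f ≈ e′ + f′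
  +-cong p q = ≈-trans (plug (□ +ˡ _) p) (plug (_ +ʳ □) q)

  +-congˡ : ∀ {e f f′} → f ≈ f′ → e + f ≈ e + f′
  +-congˡ = plug (_ +ʳ □)

  +-congʳ : ∀ {e e′ f} → e ≈ e′ → e + f ≈ e′ + f
  +-congʳ = plug (□ +ˡ _)

  ·-congˡ : ∀ {e f f′} → f ≈ f′ → e · f ≈ e · f′
  ·-congˡ = plug (_ ·ʳ □)

  ·-congʳ : ∀ {e e′ f} → e ≈ e′ → e · f ≈ e′ · f
  ·-congʳ = plug (□ ·ˡ _)

  *-cong : ∀ {e e′} → e ≈ e′ → e * ≈ e′ *
  *-cong = plug (□ *ᶜ)

  𝟎-+ : ∀ {e} → 𝟎 + e ≈ e
  𝟎-+ = ≈-trans (ax +-comm) (ax +-𝟎)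

  +-𝟎-commutativeMonoid : CommutativeMonoid a (a ⊔ ℓ)
  +-𝟎-commutativeMonoid = record
    { Carrier = StExp A
    ; _≈_ = _≈_
    ; _∙_ = _+_
    ; ε = 𝟎
    ; isCommutativeMonoid = record
      { isMonoid = record
        { isSemigroup = record
          { isMagma = record
            { isEquivalence = record { refl = ≈-refl ; sym = ≈-sym ; trans = ≈-trans }
            ; ∙-cong = +-cong }
          ; assoc = λ _ _ _ → ax +-assoc }
        ; identity = (λ _ → 𝟎-+) , (λ _ → ax +-𝟎) }
      ; comm = λ _ _ → ax +-comm } }

  open CommutativeMonoid +-𝟎-commutativeMonoid using (setoid; commutativeSemigroup)
  open CommutativeSemigroupProperties commutativeSemigroup public
    using (interchange; x∙yz≈y∙xz)

  open SetoidReasoning setoid public hiding (start)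

  -- A right-nested sum ending in `𝟎` suits induction over lists of transitions; `∑≈foldr` links it
  -- to the left-nested `∑`.
  expansion : {V : Set} → (V → StExp A) → List (Label A × V) → StExp A
  expansion s xs = foldr _+_ 𝟎 (summands s xs)

  ∑≈foldr : ∀ es → ∑ es ≈ foldr _+_ 𝟎 es
  ∑≈foldr []       = ≈-refl
  ∑≈foldr (e ∷ es) = go e es
    where
    go : ∀ e es → foldl _+_ e es ≈ e + foldr _+_ 𝟎 es
    go e []       = ≈-sym (ax +-𝟎)
    go e (f ∷ es) = ≈-trans (go (e + f) es) (ax +-assoc)

module Milner {a} (A : Set a) where
  open Equational {S = Mil A} inj₁ public

  rsp : ∀ {e f g} → ¬ f ↓ → e ≈ f · e + g → e ≈ f * · g
  rsp ¬f↓ p = by (inj₂ (rsp* ¬f↓)) (p ∷ [])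

-- Finite relations and infinite paths

module _ {V : Set} where

  record Run (_⟶_ : Rel V ℓ) (v : V) : Set ℓ where
    field
      vertex : ℕ → V
      begins : vertex zero ≡ v
      step   : ∀ i → vertex i ⟶ vertex (suc i)

  open Run

  prepend : {_⟶_ : Rel V ℓ} {v w : V} → v ⟶ w → Run _⟶_ w → Run _⟶_ v
  prepend {v = v} s r .vertex zero    = v
  prepend         s r .vertex (suc i) = r .vertex i
  prepend         s r .begins         = refl
  prepend {_⟶_ = _⟶_} {v = v} s r .step zero = subst (v ⟶_) (sym (r .begins)) s
  prepend         s r .step (suc i)   = r .step i

  -- The state is the part of the cycle still ahead; once it is used up, the whole cycle starts
  -- again.
  cycle⇒run : {_⟶_ : Rel V ℓ} {v : V} → TransClosure _⟶_ v v → Run _⟶_ v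
  cycle⇒run {_⟶_ = _⟶_} {v} c = record
    { vertex = proj₁ ∘ state
    ; begins = refl
    ; step   = λ i → next-step (state i)
    }
    where
    State : Set _
    State = ∃[ x ] TransClosure _⟶_ x v

    next : State → State
    next (_ , [ _ ]⁺) = v , c
    next (_ , _ ∷ p)  = _ , p

    next-step : ∀ s → proj₁ s ⟶ proj₁ (next s)
    next-step (_ , [ s ]⁺) = s
    next-step (_ , s ∷ _)  = s

    state : ℕ → State
    state zero    = v , c
    state (suc i) = next (state i)

  -- The transitive closure of an acyclic relation is a strict partial order, and on a finite set
  -- such an order is well-founded.
  acyclic⇒wellFounded : ∀ {n} → V ↔ Fin n → (_⟶_ : Rel V ℓ) →
                        (∀ v → ¬ TransClosure _⟶_ v v) → WellFounded (flip _⟶_)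
  acyclic⇒wellFounded {n = n} V↔Fin _⟶_ acyclic v =
    Subrelation.accessible below (On.accessible to (spo-wellFounded isSPO (to v)))
    where
    open Inverse V↔Fin using (to; from; strictlyInverseʳ)

    _⊏_ : Rel (Fin n) _
    i ⊏ j = TransClosure _⟶_ (from j) (from i)

    isSPO : IsStrictPartialOrder _≡_ _⊏_
    isSPO = record
      { isEquivalence = isEquivalence
      ; irrefl        = λ { refl → acyclic _ }
      ; trans         = flip _++⁺_
      ; <-resp-≈      = (λ { refl → id }) , (λ { refl → id })
      }

    below : ∀ {x y} → y ⟶ x → (to x) ⊏ (to y)
    below {x} {y} s rewrite strictlyInverseʳ x | strictlyInverseʳ y = [ s ]⁺

module _ {b} {B : Set b} where

  -- In a duplicate-free list equality of members is equality of positions.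
  ∈-≟ : ∀ {xs : List B} {x y} → Unique xs → x ∈ xs → y ∈ xs → Dec (x ≡ y)
  ∈-≟ _            (here refl) (here refl) = yes refl
  ∈-≟ (x∉xs ∷ _)   (here refl) (there y∈)  = no (All.lookup x∉xs y∈)
  ∈-≟ (y∉xs ∷ _)   (there x∈)  (here refl) = no (All.lookup y∉xs x∈ ∘ sym)
  ∈-≟ (_ ∷ unique) (there x∈)  (there y∈)  = ∈-≟ unique x∈ y∈

  -- This decides which transitions are entries although equality of labels may be undecidable: all
  -- candidates occur in one duplicate-free list.
  ∈?-sublist : ∀ {xs ys : List B} {x} → Unique xs → All (_∈ xs) ys → x ∈ xs → Dec (x ∈ ys)
  ∈?-sublist unique []         x∈ = no λ ()
  ∈?-sublist unique (y∈ ∷ ys⊆) x∈ with ∈-≟ unique x∈ y∈ | ∈?-sublist unique ys⊆ x∈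
  ... | yes x≡y | _       = yes (here x≡y)
  ... | no  _   | yes x∈ys = yes (there x∈ys)
  ... | no  x≢y | no  x∉ys = no λ { (here x≡y) → x≢y x≡y ; (there x∈ys) → x∉ys x∈ys }

-- Uniqueness of solutions

⌜⌝↓ : (l : Label A) → ⌜ l ⌝ ↓ → l ≡ nothing
⌜⌝↓ nothing _ = refl

module _ {a} {A : Set a} (C : OneChart A) where
  open OneChart C

  Silent : Rel V a
  Silent x y = (nothing , y) ∈ out x

  infix 4 _≟_
  _≟_ : DecidableEquality V
  _≟_ = inj⇒≟ (Inverse⇒Injection (proj₂ V-finite))

  τ-nonterminating : ∀ {v} → ¬ T (terminates v) → τ C v ≡ 𝟎
  τ-nonterminating {v} ¬t with terminates v
  ... | false = refl
  ... | true  = contradiction _ ¬t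

  StepRel : SubChart C → Rel V a
  StepRel S x y = ∃[ l ] SubChart.Step S x l y

  run⇒infinitePath : ∀ S {v} → Run (StepRel S) v → InfinitePath C S v
  run⇒infinitePath S r = record
    { vertex = Run.vertex r
    ; label  = proj₁ ∘ Run.step r
    ; begins = Run.begins r
    ; step   = proj₂ ∘ Run.step r
    }

  finitePaths⇒wellFounded : ∀ S → (∀ v → ¬ InfinitePath C S v) → WellFounded (flip (StepRel S))
  finitePaths⇒wellFounded S noPath = acyclic⇒wellFounded (proj₂ V-finite) (StepRel S)
    λ v c → noPath v (run⇒infinitePath S (cycle⇒run c))

  module _ (S : SubChart C) (E : Entries C S) where
    open SubChart S
    open Entries E

    Loop : SubChart C
    Loop = loopSubChart C S E

    loopStep⇒step : ∀ {x l y} → SubChart.Step Loop x l y → Step x l y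
    loopStep⇒step (inj₁ (entry u))     = U⊆Step u
    loopStep⇒step (inj₂ (body _ _ st)) = st

    loopVertex⇒vertex : ∀ {w} → LoopVertex C S E w → Vertex w
    loopVertex⇒vertex at-v                = fromEntry U-nonempty U⊆Step
      where
      fromEntry : ∀ {xs} → xs ≢ [] → (∀ {l w} → (l , w) ∈ xs → Step v l w) → Vertex v
      fromEntry {[]}    []≢[] _      = contradiction refl []≢[]
      fromEntry {_ ∷ _} _     xs⊆Step = source∈ (xs⊆Step (here refl))
    loopVertex⇒vertex (after-entry st)    = target∈ (loopStep⇒step (inj₁ st))
    loopVertex⇒vertex (after-body st)     = target∈ (loopStep⇒step (inj₂ st))

    reachable⇒vertex : ∀ {w} → Reachable C S E w → Vertex w
    reachable⇒vertex = go root∈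
      where
      go : ∀ {x w} → Vertex x → Star (λ x y → ∃[ l ] Remaining C S E x l y) x w → Vertex w
      go x∈ ε                  = x∈
      go _  ((_ , st , _) ◅ p) = go (target∈ st) p

    -- Steps of the loop that do not return to its root.
    Bypass : Rel V a
    Bypass x y = StepRel Loop x y × y ≢ v

    -- The derivation that `x` is a loop vertex is a path from `v` to `x`; the run is prolonged
    -- backwards along it.
    attach : ∀ {x} → LoopVertex C S E x → x ≢ v → Run Bypass x → Run Bypass v
    attach at-v                          x≢v r = contradiction refl x≢v
    attach (after-entry (entry u))       x≢v r = prepend ((_ , inj₁ (entry u)) , x≢v) r
    attach (after-body (body y∈ y≢v st)) x≢v r =
      attach y∈ y≢v (prepend ((_ , inj₂ (body y∈ y≢v st)) , x≢v) r)

    -- A cycle of `Bypass` gives, after `attach`, an infinite path from `v` that never returns to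
    -- `v`, contrary to (L2).
    bypass-wellFounded : IsLoop C Loop → WellFounded (flip Bypass)
    bypass-wellFounded isLoop = acyclic⇒wellFounded (proj₂ V-finite) Bypass acyclic
      where
      open IsLoop isLoop

      first∈ : ∀ {x y} → TransClosure Bypass x y → LoopVertex C S E x
      first∈ [ (_ , s) , _ ]⁺     = SubChart.source∈ Loop s
      first∈ (((_ , s) , _) ∷ _)  = SubChart.source∈ Loop s

      last≢v : ∀ {x y} → TransClosure Bypass x y → y ≢ v
      last≢v [ _ , y≢v ]⁺ = y≢v
      last≢v (_ ∷ p)      = last≢v p

      acyclic : ∀ x → ¬ TransClosure Bypass x x
      acyclic x c = case L2 path of λ (i , eq) → proj₂ (Run.step r i) eq
        where
        r : Run Bypass v
        r = attach (first∈ c) (last≢v c) (cycle⇒run c)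

        path : InfinitePath C Loop v
        path = run⇒infinitePath Loop record { Run r ; step = proj₁ ∘ Run.step r }

  cycle : ∀ {x y z} → Silent x y → Star Silent y z → TransClosure Silent x z
  cycle p ε       = [ p ]⁺
  cycle p (q ◅ r) = p ∷ cycle q r

  module Soundness (wg : WeaklyGuarded C) {I : Set} (s : I → V → StExp A)
    (solution : ∀ i → IsSolution C (Mil A) (s i)) where

    open Milner A

    -- A factor common to all solutions; in a loop at v one takes r i = s i v, and
    -- for Q w the existence of a path of 1-transitions from w to v.
    record Factor (r : I → StExp A) (Q : V → Set a) (w : V) : Set a where
      field
        factor   : StExp A
        equation : ∀ i → s i w ≈ factor · r i
        silent   : factor ↓ → Q w

    -- Distributivity collects the factors. A summand terminates only if its label is 1 and its own
    -- factor terminates, which yields the witness `y`.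
    factorExpansion : ∀ {r Q} xs → All (Factor r Q ∘ proj₂) xs →
      Σ[ t ∈ StExp A ] (∀ i → expansion (s i) xs ≈ t · r i) ×
                       (t ↓ → ∃[ y ] (nothing , y) ∈ xs × Q y)
    factorExpansion []             []       = 𝟎 , (λ i → ≈-sym (ax 𝟎-·)) , λ ()
    factorExpansion {r} {Q} ((l , y) ∷ xs) (p ∷ ps) with factorExpansion xs ps
    ... | t , eq , silentₜ = ⌜ l ⌝ · factor + t , eq′ , silent′
      where
      open Factor p

      eq′ : ∀ i → ⌜ l ⌝ · s i y + expansion (s i) xs ≈ (⌜ l ⌝ · factor + t) · r i
      eq′ i = begin
        ⌜ l ⌝ · s i y + expansion (s i) xs     ≈⟨ +-cong (·-congˡ (equation i)) (eq i) ⟩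
        ⌜ l ⌝ · (factor · r i) + t · r i       ≈⟨ +-congʳ (ax ·-assoc) ⟨
        (⌜ l ⌝ · factor) · r i + t · r i       ≈⟨ ax ·-distʳ-+ ⟨
        (⌜ l ⌝ · factor + t) · r i             ∎

      silent′ : (⌜ l ⌝ · factor + t) ↓ → ∃[ z ] (nothing , z) ∈ (l , y) ∷ xs × Q z
      silent′ (+↓₁ (·↓ l↓ f↓)) = y , here (cong (_, y) (sym (⌜⌝↓ l l↓))) , silent f↓
      silent′ (+↓₂ t↓) = case silentₜ t↓ of λ (z , z∈ , q) → z , there z∈ , q

    module _ (S : SubChart C) where
      open SubChart S

      record Equation (w : V) : Set a where
        field
          loops     : StExp A
          rest      : List (Label A × V)
          ¬loops↓   : ¬ loops ↓
          equation  : ∀ i → s i w ≈ loops · s i w + (τ C w + expansion (s i) rest)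
          rest⊆Step : All (λ (l , y) → Step w l y) rest

    open Equation using (rest)

    -- RSP* solves the equation for `s i w`, and distributivity moves `r i` to the right end. This
    -- serves both loops, with `r i` the value at the root, and the final acyclic chart, with `r i`
    -- equal to `𝟏`.
    factorize : ∀ {S r Q w} (eq : Equation S w) →
      (∀ i → τ C w ≈ τ C w · r i) → (τ C w ↓ → Q w) → (∀ {y} → Silent w y → Q y → Q w) →
      All (Factor r Q ∘ proj₂) (rest eq) → Factor r Q w
    factorize {S} {r} {Q} {w} eq τ≈ τ↓ back ps with factorExpansion (rest eq) ps
    ... | t , t≈ , silentₜ = record
      { factor   = loops * · (τ C w + t)
      ; equation = λ i → begin
          s i w                                      ≈⟨ rsp ¬loops↓ (equation i) ⟩
          loops * · (τ C w + expansion (s i) rest′)  ≈⟨ ·-congˡ (+-cong (τ≈ i) (t≈ i)) ⟩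
          loops * · (τ C w · r i + t · r i)          ≈⟨ ·-congˡ (ax ·-distʳ-+) ⟨
          loops * · ((τ C w + t) · r i)              ≈⟨ ax ·-assoc ⟨
          loops * · (τ C w + t) · r i                ∎
      ; silent   = λ where
          (·↓ _ (+↓₁ p)) → τ↓ p
          (·↓ _ (+↓₂ p)) → case silentₜ p of λ (y , y∈ , q) →
            back (Step⊆out (All.lookup rest⊆Step y∈)) q
      }
      where
      open Equation eq renaming (rest to rest′)
      open SubChart S using (Step⊆out)

    split : {U : List (Label A × V)} {P : Pred (Label A × V) a} → ∀ xs →
      All (λ x → Dec (x ∈ U)) xs → All P xs →
      Σ[ ys ∈ List (Label A × V) ] Σ[ zs ∈ List (Label A × V) ]
        (∀ i → expansion (s i) xs ≈ expansion (s i) ys + expansion (s i) zs) ×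
        All (_∈ U) ys × All (λ x → P x × ¬ x ∈ U) zs
    split []       []        []       = [] , [] , (λ i → ≈-sym 𝟎-+) , [] , []
    split (x ∷ xs) (x∈? ∷ d) (p ∷ ps) with x∈? | split xs d ps
    ... | yes x∈U | ys , zs , eq , ys⊆ , zs⊆ =
      x ∷ ys , zs , (λ i → ≈-trans (+-congˡ (eq i)) (≈-sym (ax +-assoc))) , x∈U ∷ ys⊆ , zs⊆
    ... | no  x∉U | ys , zs , eq , ys⊆ , zs⊆ =
      ys , x ∷ zs , (λ i → ≈-trans (+-congˡ (eq i)) (x∙yz≈y∙xz _ _ _)) , ys⊆ , (p , x∉U) ∷ zs⊆

    module _ {S : SubChart C} (E : Entries C S) (isLoop : IsLoop C (loopSubChart C S E))
      (equations : ∀ {w} → SubChart.Vertex S w → Equation S w) where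

      open SubChart S
      open Entries E
      open IsLoop isLoop

      LoopFactor : V → Set a
      LoopFactor = Factor (λ i → s i v) (λ w → Star Silent w v)

      atRoot : LoopFactor v
      atRoot = record { factor = 𝟏 ; equation = λ i → ≈-sym (ax 𝟏-·) ; silent = λ _ → ε }

      -- The recursion follows `Bypass`; a step back to `v` ends it with factor `𝟏`.
      loopFactor : ∀ {w} → LoopVertex C S E w → LoopFactor w
      loopFactor w∈ = go (bypass-wellFounded S E isLoop _) w∈
        where
        go : ∀ {w} → Acc (flip (Bypass S E)) w → LoopVertex C S E w → LoopFactor w
        go {w} (acc rs) w∈ with w ≟ v
        ... | yes refl = atRoot
        ... | no  w≢v  = factorize eq τ≈ τ↓ _◅_ (All.map next (Equation.rest⊆Step eq))
          where
          eq = equations (loopVertex⇒vertex S E w∈)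

          -- By (L3) only the root may terminate; a summand `𝟏` here could not be written as a
          -- multiple of `s i v`.
          τ≡𝟎 : τ C w ≡ 𝟎
          τ≡𝟎 = τ-nonterminating λ t → w≢v (L3 w∈ t)

          τ≈ : ∀ i → τ C w ≈ τ C w · s i v
          τ≈ i rewrite τ≡𝟎 = ≈-sym (ax 𝟎-·)

          τ↓ : ∀ {X : Set a} → τ C w ↓ → X
          τ↓ rewrite τ≡𝟎 = λ ()

          next : ∀ {x} → Step w (proj₁ x) (proj₂ x) → LoopFactor (proj₂ x)
          next {_ , y} st with y ≟ v
          ... | yes refl = atRoot
          ... | no  y≢v  = go (rs ((_ , inj₂ b) , y≢v)) (after-body b)
            where b = body w∈ w≢v st

      U⊆out : All (_∈ out v) U
      U⊆out = All.tabulate (Step⊆out ∘ U⊆Step)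

      -- Away from `v` the listed transitions all survive. At `v` those in `U` sum up to
      -- `t · s i v`, which is merged into `loops`.
      eliminated : ∀ {w} → Reachable C S E w → Equation (eliminate C S E) w
      eliminated {w} w∈ with w ≟ v | equations (reachable⇒vertex S E w∈)
      ... | no w≢v | eq = record
        { Equation eq
        ; rest⊆Step = All.map (λ st → w∈ , st , λ { (entry _) → w≢v refl }) (Equation.rest⊆Step eq) }
      ... | yes refl | eq
        with ys , zs , xs≈ , ys⊆U , zs⊆ ← split {U} (rest eq)
               (All.map (∈?-sublist (out-unique v) U⊆out ∘ Step⊆out) (Equation.rest⊆Step eq))
               (Equation.rest⊆Step eq)
        with t , t≈ , silentₜ ← factorExpansion ys
               (All.map (λ u → loopFactor (after-entry (entry u))) ys⊆U)
        = record
        { loops     = loops + t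
        ; rest      = zs
        ; ¬loops↓   = λ where
            (+↓₁ p) → ¬loops↓ p
            -- Termination of `t` means a silent entry to some `y` and a silent path from `y` back
            -- to `v`.
            (+↓₂ p) → case silentₜ p of λ (y , y∈ , q) →
              wg v (cycle (Step⊆out (U⊆Step (All.lookup ys⊆U y∈))) q)
        ; equation  = λ i → begin
            s i v                                       ≈⟨ equation i ⟩
            loops · s i v + (τ C v + expansion (s i) (rest eq))
              ≈⟨ +-congˡ (+-congˡ (≈-trans (xs≈ i) (+-congʳ (t≈ i)))) ⟩
            loops · s i v + (τ C v + (t · s i v + expansion (s i) zs))
              ≈⟨ +-congˡ (x∙yz≈y∙xz _ _ _) ⟩
            loops · s i v + (t · s i v + (τ C v + expansion (s i) zs))
              ≈⟨ ax +-assoc ⟨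
            (loops · s i v + t · s i v) + (τ C v + expansion (s i) zs)
              ≈⟨ +-congʳ (ax ·-distʳ-+) ⟨
            (loops + t) · s i v + (τ C v + expansion (s i) zs) ∎
        ; rest⊆Step = All.map (λ (st , ∉U) → w∈ , st , λ { (entry u) → ∉U u }) zs⊆
        }
        where
        open Equation eq hiding (rest)

    -- With `𝟏` as right factor the value no longer depends on the solution.
    Value : V → Set a
    Value = Factor (λ _ → 𝟏) (λ _ → ⊤ₚ)

    value : ∀ {S} → Elimination C S → (∀ {w} → SubChart.Vertex S w → Equation S w) →
            Value (SubChart.root S)
    value {S} (stop noPath) equations = go (finitePaths⇒wellFounded S noPath _) (SubChart.root∈ S)
      where
      open SubChart S

      go : ∀ {w} → Acc (flip (StepRel S)) w → Vertex w → Value w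
      go (acc rs) w∈ = factorize (equations w∈) (λ i → ≈-sym (ax ·-𝟏)) _ _
        (All.map (λ st → go (rs (_ , st)) (target∈ st)) (Equation.rest⊆Step (equations w∈)))
    value (elim E isLoop seq) equations = value seq (eliminated E isLoop equations)

    initial : ∀ w → Equation (whole C) w
    initial w = record
      { loops = 𝟎
      ; rest = out w
      ; ¬loops↓ = λ ()
      ; equation = λ i → begin
          s i w
            ≈⟨ solution i w ⟩
          τ C w + ∑ (summands (s i) (out w))
            ≈⟨ +-congˡ (∑≈foldr (summands (s i) (out w))) ⟩
          τ C w + expansion (s i) (out w)
            ≈⟨ 𝟎-+ ⟨
          𝟎 + (τ C w + expansion (s i) (out w))
            ≈⟨ +-congʳ (ax 𝟎-·) ⟨
          𝟎 · s i w + (τ C w + expansion (s i) (out w)) ∎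
      ; rest⊆Step = All.tabulate id
      }

    solutions-agree : LLEE C → ∀ i j → s i start ≈ s j start
    solutions-agree (seq , _) i j = ≈-trans (equation i) (≈-sym (equation j))
      where open Factor (value seq λ {w} _ → initial w)

-- Soundness of the coinductive rules in Milner's system

discharge : {Γ : List (Eq A)} → All (Mil A ⊢_) Γ → ∀ {q} → Mil⁻+ (_∈ Γ) ⊢ q → Mil A ⊢ q
discharge ps = translate λ where
  (inj₁ r)          qs → by (inj₁ r) qs
  (inj₂ (axiom q∈)) _  → All.lookup ps q∈

-- Derivable premises may replace the added axioms, so both sides of the coinductive proof are
-- solutions over `Mil A`, and solutions agree at the start.
LCoProof-sound : {A : Set a} {Γ : List (Eq A)} {q : Eq A} (P : CoinductiveProof (Mil⁻+ (_∈ Γ)) q) →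
                 LLEEWitnessed P → All (Mil A ⊢_) Γ → Mil A ⊢ q
LCoProof-sound {A = A} P llee ps = subst₂ (λ e f → Mil A ⊢ e ≐ f) (sym lhs≡) (sym rhs≡)
  (Soundness.solutions-agree chart weaklyGuarded side solution llee true false)
  where
  open CoinductiveProof P
  open OneChart chart using (V)

  side : Bool → V → StExp A
  side true  = lhs ∘ L
  side false = rhs ∘ L

  solution : ∀ i → IsSolution chart (Mil A) (side i)
  solution true  = discharge ps ∘ solution₁
  solution false = discharge ps ∘ solution₂

cMil⇒Mil : ∀ {q} → cMil A ⊢ q → Mil A ⊢ q
cMil⇒Mil = translate λ where
  (inj₁ r)                  ps → by (inj₁ r) ps
  (inj₂ (_ , _ , P , llee)) ps → LCoProof-sound P llee ps

-- Normal forms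

infix 5 _↓?

_↓? : (e : StExp A) → Dec (e ↓)
𝟎 ↓?       = no λ ()
𝟏 ↓?       = yes 𝟏↓
act _ ↓?   = no λ ()
(e + f) ↓? = map′ (λ { (inj₁ p) → +↓₁ p ; (inj₂ p) → +↓₂ p })
                  (λ { (+↓₁ p) → inj₁ p ; (+↓₂ p) → inj₂ p }) (e ↓? ⊎-dec f ↓?)
(e · f) ↓? = map′ (λ (p , q) → ·↓ p q) (λ { (·↓ p q) → p , q }) (e ↓? ×-dec f ↓?)
(e *) ↓?   = yes *↓

-- e can terminate, possibly after some actions.
data Live {A : Set a} : StExp A → Set a where
  𝟏   : Live 𝟏
  act : ∀ x → Live (act x)
  +₁  : ∀ {e f} → Live e → Live (e + f)
  +₂  : ∀ {e f} → Live f → Live (e + f)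
  _·_ : ∀ {e f} → Live e → Live f → Live (e · f)
  _*  : ∀ e → Live (e *)

live? : (e : StExp A) → Dec (Live e)
live? 𝟎       = no λ ()
live? 𝟏       = yes 𝟏
live? (act x) = yes (act x)
live? (e + f) = map′ (λ { (inj₁ p) → +₁ p ; (inj₂ p) → +₂ p })
                     (λ { (+₁ p) → inj₁ p ; (+₂ p) → inj₂ p }) (live? e ⊎-dec live? f)
live? (e · f) = map′ (λ (p , q) → p · q) (λ { (p · q) → p , q }) (live? e ×-dec live? f)
live? (e *)   = yes (e *)

-- Liveness of left factors and of bodies of stars makes every vertex of the chart
-- reachable and every star vertex the start of an actual loop; guarded bodies of
-- stars make the chart weakly guarded.
data Normal {A : Set a} : StExp A → Set a where
  𝟎    : Normal 𝟎
  𝟏    : Normal 𝟏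
  act  : ∀ x → Normal (act x)
  _+_  : ∀ {e f} → Normal e → Normal f → Normal (e + f)
  prod : ∀ {e f} → Live e → Normal e → Normal f → Normal (e · f)
  iter : ∀ {e} → Live e → ¬ e ↓ → Normal e → Normal (e *)

-- A product that drops its right factor if the left one is dead (see dead-·).
infixl 7 _⊙_

_⊙_ : StExp A → StExp A → StExp A
e ⊙ f = if does (live? e) then e · f else e

constant positive normalize : StExp A → StExp A
constant e = if does (e ↓?) then 𝟏 else 𝟎

positive 𝟎       = 𝟎
positive 𝟏       = 𝟎
positive (act x) = act x
positive (e + f) = positive e + positive f
-- Splitting `e` into constant and positive part leaves a summand `f` exactly when `e` terminates;
-- only its positive part is kept.
positive (e · f) = positive e ⊙ normalize f + (if does (e ↓?) then positive f else 𝟎)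
-- The star is rebuilt over the positive part of its body and unfolded once, without the summand
-- `𝟏`.
positive (e *)   = positive e ⊙ positive e *

normalize e = constant e + positive e

⊙-¬↓ : (e f : StExp A) → ¬ e ↓ → ¬ (e ⊙ f) ↓
⊙-¬↓ e f ¬e↓ p with live? e
⊙-¬↓ e f ¬e↓ (·↓ p _) | yes _ = ¬e↓ p
⊙-¬↓ e f ¬e↓ p        | no _  = ¬e↓ p

positive-¬↓ : (e : StExp A) → ¬ positive e ↓
positive-¬↓ (e + f) (+↓₁ p) = positive-¬↓ e p
positive-¬↓ (e + f) (+↓₂ p) = positive-¬↓ f p
positive-¬↓ (e · f) (+↓₁ p) = ⊙-¬↓ (positive e) (normalize f) (positive-¬↓ e) p
positive-¬↓ (e · f) (+↓₂ p) with e ↓?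
... | yes _ = positive-¬↓ f p
positive-¬↓ (e *)   p       = ⊙-¬↓ (positive e) (positive e *) (positive-¬↓ e) p

⊙-normal : {e f : StExp A} → Normal e → (Live e → Normal f) → Normal (e ⊙ f)
⊙-normal {e = e} n m with live? e
... | yes l = prod l n (m l)
... | no _  = n

constant-normal  : (e : StExp A) → Normal (constant e)
positive-normal  : (e : StExp A) → Normal (positive e)
normalize-normal : (e : StExp A) → Normal (normalize e)

constant-normal e with e ↓?
... | yes _ = 𝟏
... | no _  = 𝟎

positive-normal 𝟎       = 𝟎
positive-normal 𝟏       = 𝟎
positive-normal (act x) = act x
positive-normal (e + f) = positive-normal e + positive-normal f
positive-normal (e · f) = ⊙-normal (positive-normal e) (λ _ → normalize-normal f) + optional
  where
  optional : Normal (if does (e ↓?) then positive f else 𝟎)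
  optional with e ↓?
  ... | yes _ = positive-normal f
  ... | no _  = 𝟎
positive-normal (e *)   =
  ⊙-normal (positive-normal e) λ l → iter l (positive-¬↓ e) (positive-normal e)

normalize-normal e = constant-normal e + positive-normal e

module NormalForm {a ℓ} {A : Set a} {S : System A ℓ}
  (mil⁻ : ∀ {Γ q} → Mil⁻ A Γ q → S Γ q) where

  open Equational {S = S} mil⁻ public

  -- What follows a dead expression is never reached. The induction starts from `𝟎 · f = 𝟎`; in a
  -- product it drops `f` behind whichever factor is dead.
  dead-· : ∀ e {f} → ¬ Live e → e · f ≈ e
  dead-· 𝟎       _ = ax 𝟎-·
  dead-· 𝟏       d = contradiction 𝟏 d
  dead-· (act x) d = contradiction (act x) d
  dead-· (e + f) d = ≈-trans (ax ·-distʳ-+) (+-cong (dead-· e (d ∘ +₁)) (dead-· f (d ∘ +₂)))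
  dead-· (e · g) d with live? e
  ... | yes l = ≈-trans (ax ·-assoc) (·-congˡ (dead-· g (d ∘ (l ·_))))
  ... | no ¬l = ≈-trans (ax ·-assoc) (≈-trans (dead-· e ¬l) (≈-sym (dead-· e ¬l)))
  dead-· (e *)   d = contradiction (e *) d

  ⊙≈· : ∀ e f → e ⊙ f ≈ e · f
  ⊙≈· e f with live? e
  ... | yes _ = ≈-refl
  ... | no ¬l = ≈-sym (dead-· e ¬l)

  normalize≈ : ∀ e → normalize e ≈ e
  normalize≈ 𝟎       = 𝟎-+
  normalize≈ 𝟏       = ax +-𝟎
  normalize≈ (act x) = 𝟎-+
  normalize≈ (e + f) = begin
    constant (e + f) + (positive e + positive f)            ≈⟨ +-congʳ constants ⟩
    (constant e + constant f) + (positive e + positive f)   ≈⟨ interchange _ _ _ _ ⟩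
    normalize e + normalize f                               ≈⟨ +-cong (normalize≈ e) (normalize≈ f) ⟩
    e + f                                                   ∎
    where
    constants : constant (e + f) ≈ constant e + constant f
    constants with e ↓? | f ↓?
    ... | yes _ | yes _ = ≈-sym (ax +-idem)
    ... | yes _ | no _  = ≈-sym (ax +-𝟎)
    ... | no _  | yes _ = ≈-sym 𝟎-+
    ... | no _  | no _  = ≈-sym (ax +-𝟎)
  normalize≈ (e · f) = begin
    constant (e · f) + (positive e ⊙ normalize f + (if does (e ↓?) then positive f else 𝟎))
      ≈⟨ x∙yz≈y∙xz _ _ _ ⟩
    positive e ⊙ normalize f + (constant (e · f) + (if does (e ↓?) then positive f else 𝟎))
      ≈⟨ +-cong (≈-trans (⊙≈· (positive e) (normalize f)) (·-congˡ (normalize≈ f))) constants ⟩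
    positive e · f + constant e · f     ≈⟨ ax +-comm ⟩
    constant e · f + positive e · f     ≈⟨ ax ·-distʳ-+ ⟨
    normalize e · f                     ≈⟨ ·-congʳ (normalize≈ e) ⟩
    e · f                               ∎
    where
    constants : constant (e · f) + (if does (e ↓?) then positive f else 𝟎) ≈ constant e · f
    constants with e ↓?
    -- Since `e` terminates, `constant (e · f)` computes to `constant f`, and the left side is
    -- `normalize f`.
    ... | yes _ = ≈-trans (normalize≈ f) (≈-sym (ax 𝟏-·))
    ... | no _  = ≈-trans (ax +-𝟎) (≈-sym (ax 𝟎-·))
  normalize≈ (e *)   = begin
    𝟏 + positive e ⊙ positive e *   ≈⟨ +-congˡ (⊙≈· (positive e) (positive e *)) ⟩
    𝟏 + positive e · positive e *   ≈⟨ ax *-unfold ⟨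
    positive e *                    ≈⟨ absorb ⟩
    normalize e *                   ≈⟨ *-cong (normalize≈ e) ⟩
    e *                             ∎
    where
    -- The constant of a terminating body is absorbed by the axiom `*-𝟏+`.
    absorb : positive e * ≈ normalize e *
    absorb with e ↓?
    ... | yes _ = ax *-𝟏+
    ... | no _  = *-cong (≈-sym 𝟎-+)

  positive≈ : ∀ {e} → ¬ e ↓ → positive e ≈ e
  positive≈ {e} ¬e↓ = ≈-trans positive≈normalize (normalize≈ e)
    where
    positive≈normalize : positive e ≈ normalize e
    positive≈normalize with e ↓?
    ... | yes e↓ = contradiction e↓ ¬e↓
    ... | no _   = ≈-sym 𝟎-+

-- A criterion for LLEE

++-disjoint : ∀ {B : Set a} (xs : List B) {ys x} → Unique (xs ++ ys) → x ∈ xs → ¬ x ∈ ys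
++-disjoint (_ ∷ xs) (x∉ ∷ _)     (here refl) x∈ys = All.lookup x∉ (∈-++⁺ʳ xs x∈ys) refl
++-disjoint (_ ∷ xs) (_ ∷ unique) (there x∈)  x∈ys = ++-disjoint xs unique x∈ x∈ys

module Layering {a} {A : Set a} (C : OneChart A) where
  open OneChart C

  -- The loops start at the vertices in loops, with the transitions in entries;
  -- inner loops come first.  Removing all entries leaves an acyclic chart, ranked
  -- by rank.  By forth, v stays reachable as long as only loops whose
  -- region does not contain v have been eliminated.
  record LayeredWitness : Set (Level.suc Level.zero ⊔ a) where
    field
      entries bodies        : V → List (Label A × V)
      Region                : V → V → Set
      out≡                  : ∀ x → out x ≡ entries x ++ bodies x

    BodyRel : Rel V a
    BodyRel x y = ∃[ l ] (l , y) ∈ bodies x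

    Returns : V → Set a
    Returns v = Σ[ t ∈ Label A × V ] t ∈ entries v × Star BodyRel (proj₂ t) v

    Reaching : V → Rel V a
    Reaching v x y = ∃[ l ] ((l , y) ∈ bodies x ⊎ (l , y) ∈ entries x × Region x v)

    field
      rank                  : V → ℕ
      rank-body             : ∀ {x l y} → (l , y) ∈ bodies x → rank y < rank x
      region-root           : ∀ {v t} → t ∈ entries v → Region v v
      region-entry          : ∀ {v l y} → (l , y) ∈ entries v → Region v y
      region-step           : ∀ {v x l y} → Region v x → x ≢ v → (l , y) ∈ out x → Region v y
      region-nonterminating : ∀ {v x} → Region v x → ¬ T (terminates x)
      loops                 : List V
      loops-complete        : ∀ {v t} → t ∈ entries v → v ∈ loops
      loops-sorted          : AllPairs (λ v u → ¬ Region v u) loops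
      back                  : All Returns loops
      forth                 : ∀ {v t} → t ∈ entries v → Star (Reaching v) start v

  module _ (W : LayeredWitness) where
    open LayeredWitness W

    Current : List V → V → Label A → V → Set a
    Current vs x l y = (l , y) ∈ bodies x ⊎ (l , y) ∈ entries x × x ∈ vs

    -- The entries still present in S are those of the vertices in vs.
    record Stage (vs : List V) (S : SubChart C) : Set a where
      open SubChart S
      field
        step⇒current : ∀ {x l y} → Step x l y → Current vs x l y
        current⇒step : ∀ {x l y} → Vertex x → Current vs x l y → Step x l y
        root≡start   : root ≡ start
        -- The loops around a root still to be treated are present as well, which keeps the paths of
        -- `forth` intact.
        enclosing    : ∀ {v u t} → v ∈ vs → t ∈ entries u → Region u v → u ∈ vs

    noDescent : (f : ℕ → ℕ) → ¬ (∀ i → f (suc i) < f i)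
    noDescent f f↓ = go (suc (f 0)) 0 ℕ.≤-refl
      where
      go : ∀ n i → ¬ f i < n
      go (suc n) i (s≤s fi≤n) = go n (suc i) (ℕ.<-≤-trans (f↓ i) fi≤n)

    module Elim {v vs S} (stage : Stage (v ∷ vs) S)
      (v-minimal : All (λ u → ¬ Region v u) vs)
      (v-back : Returns v) where
      open SubChart S
      open Stage stage

      -- Every entry used on the path belongs to a loop around `v`, hence is still present by
      -- `enclosing`.
      reach : ∀ {x} → Vertex x → Star (Reaching v) x v → Vertex v
      reach x∈ ε                          = x∈
      reach x∈ ((_ , inj₁ b) ◅ p)         = reach (target∈ (current⇒step x∈ (inj₁ b))) p
      reach x∈ ((_ , inj₂ (e , x∋v)) ◅ p) =
        reach (target∈ (current⇒step x∈ (inj₂ (e , enclosing (here refl) e x∋v)))) p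

      v∈ : Vertex v
      v∈ = reach (subst Vertex root≡start root∈) (forth (proj₁ (proj₂ v-back)))

      E : Entries C S
      E = record
        { v = v
        ; U = entries v
        ; U-nonempty = nonempty (proj₁ (proj₂ v-back))
        ; U⊆Step = λ e → current⇒step v∈ (inj₂ (e , here refl))
        }
        where
        nonempty : ∀ {t : Label A × V} {ts} → t ∈ ts → ts ≢ []
        nonempty (here _)  ()
        nonempty (there _) ()

      loopVertex⇒region : ∀ {x} → LoopVertex C S E x → Region v x
      loopVertex⇒region at-v = region-root (proj₁ (proj₂ v-back))
      loopVertex⇒region (after-entry (entry e)) = region-entry e
      loopVertex⇒region (after-body (body x∈ x≢v st)) =
        region-step (loopVertex⇒region x∈) x≢v (Step⊆out st)

      -- An entry among these steps would start a remaining loop inside the region of `v`, contrary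
      -- to minimality.
      bodyStep⇒body : ∀ {x l y} → BodyStep C S E x l y → (l , y) ∈ bodies x
      bodyStep⇒body (body x∈ x≢v st) with step⇒current st
      ... | inj₁ b                = b
      ... | inj₂ (_ , here x≡v)   = contradiction x≡v x≢v
      ... | inj₂ (_ , there x∈vs) = contradiction (loopVertex⇒region x∈) (All.lookup v-minimal x∈vs)

      entry-source : ∀ {x l y} → EntryStep C S E x l y → x ≡ v
      entry-source (entry _) = refl

      isLoop : IsLoop C (Loop C S E)
      isLoop = record { L1 = L1 ; L2 = L2 ; L3 = L3 }
        where
        -- The returning path is cut at its first visit to `v`, where the loop ends.
        close : ∀ {y x} → StepRel C (Loop C S E) y x → Star BodyRel x v →
                TransClosure (StepRel C (Loop C S E)) y v
        close s ε = [ s ]⁺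
        close {x = x} s ((_ , b) ◅ p) with _≟_ C x v
        ... | yes refl = [ s ]⁺
        ... | no x≢v   = s ∷ close (_ , inj₂ (body x∈ x≢v st)) p
          where
          x∈ = SubChart.target∈ (Loop C S E) (proj₂ s)
          st = current⇒step (loopVertex⇒vertex C S E x∈) (inj₁ b)

        L1 : InfinitePath C (Loop C S E) v
        L1 = case v-back of λ (_ , e , p) →
          run⇒infinitePath C (Loop C S E) (cycle⇒run (close (_ , inj₁ (entry e)) p))

        -- Body steps lower the rank, so some step is an entry, and its source is `v`. The search
        -- begins with step 1 because the return must take a positive number of steps.
        L2 : (p : InfinitePath C (Loop C S E) v) → ∃[ i ] InfinitePath.vertex p (suc i) ≡ v
        L2 p = go _ 0 ℕ.≤-refl
          where
          open InfinitePath p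
          go : ∀ n i → rank (vertex (suc i)) < n → ∃[ i ] vertex (suc i) ≡ v
          go (suc n) i (s≤s r≤n) with step (suc i)
          ... | inj₁ e = i , entry-source e
          ... | inj₂ b = go n (suc i) (ℕ.<-≤-trans (rank-body (bodyStep⇒body b)) r≤n)

        L3 : ∀ {x} → LoopVertex C S E x → T (terminates x) → x ≡ v
        L3 x∈ t = contradiction t (region-nonterminating (loopVertex⇒region x∈))

      nextStage : Stage vs (eliminate C S E)
      nextStage = record
        { step⇒current = λ (_ , st , ¬e) → case step⇒current st of λ where
            (inj₁ b)                → inj₁ b
            (inj₂ (e , here refl))  → contradiction (entry e) ¬e
            (inj₂ (e , there x∈vs)) → inj₂ (e , x∈vs)
        ; current⇒step = λ x∈ c → x∈ , remaining (reachable⇒vertex C S E x∈) c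
        ; root≡start = root≡start
        ; enclosing = λ w∈vs e u∋w → case enclosing (there w∈vs) e u∋w of λ where
            (here refl)  → contradiction u∋w (All.lookup v-minimal w∈vs)
            (there u∈vs) → u∈vs
        }
        where
        remaining : ∀ {x l y} → Vertex x → Current vs x l y → Remaining C S E x l y
        remaining x∈ (inj₁ b) = current⇒step x∈ (inj₁ b) , λ where
          -- Entries and bodies of `v` are disjoint because `out v` has no repetitions.
          (entry e) → ++-disjoint (entries v) (subst Unique (out≡ v) (out-unique v)) e b
        remaining x∈ (inj₂ (e , x∈vs)) = current⇒step x∈ (inj₂ (e , there x∈vs)) , λ where
          (entry e) → All.lookup v-minimal x∈vs (region-root e)

    -- The last conjunct says that only entries of vertices in `vs` are used; layeredness of the
    -- preceding elimination follows from it.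
    LayeredElimination : List V → SubChart C → Set (Level.suc a)
    LayeredElimination vs S = Σ[ seq ∈ Elimination C S ] Layered C seq ×
      (∀ B → (∀ {u l y} → u ∈ vs → (l , y) ∈ entries u → ¬ B u l y) → EntriesAvoid C B seq)

    eliminateAll : ∀ vs {S} → Stage vs S → AllPairs (λ v u → ¬ Region v u) vs →
                   All Returns vs → LayeredElimination vs S
    eliminateAll [] {S} stage [] [] = stop finite , _ , _
      where
      open Stage stage
      finite : ∀ v → ¬ InfinitePath C S v
      finite v p = noDescent (rank ∘ vertex) λ i → case step⇒current (step i) of λ where
          (inj₁ b) → rank-body b
        where open InfinitePath p
    eliminateAll (v ∷ vs) stage (v-minimal ∷ sorted) (v-back ∷ back)
      with eliminateAll vs (Elim.nextStage stage v-minimal v-back) sorted back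
    ... | seq , layered , avoid =
      elim E isLoop seq ,
      -- Body steps of the loop at `v` start in its region, which by minimality contains no root of
      -- a later loop.
      (avoid _ (λ u∈vs e b → All.lookup v-minimal u∈vs (bodyStep-source b)) , layered) ,
      λ B ¬B → (λ { (entry e) → ¬B (here refl) e }) , avoid B (¬B ∘ there)
      where
      open Elim stage v-minimal v-back
      bodyStep-source : ∀ {x l y} → BodyStep C _ E x l y → Region v x
      bodyStep-source (body x∈ _ _) = loopVertex⇒region x∈

    witness⇒LLEE : LLEE C
    witness⇒LLEE =
      case eliminateAll loops initial loops-sorted back of λ (seq , layered , _) → seq , layered
      where
      initial : Stage loops (whole C)
      initial = record
        { step⇒current = λ {x} t → case ∈-++⁻ (entries x) (subst (_ ∈_) (out≡ x) t) of λ where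
            (inj₁ e) → inj₂ (e , loops-complete e)
            (inj₂ b) → inj₁ b
        ; current⇒step = λ {x} _ c → subst (_ ∈_) (sym (out≡ x)) (case c of λ where
            (inj₁ b)       → ∈-++⁺ʳ (entries x) b
            (inj₂ (e , _)) → ∈-++⁺ˡ e)
        ; root≡start = refl
        ; enclosing = λ _ e _ → loops-complete e
        }

-- Charts of star expressions

pattern top = inj₁ tt
pattern left x = inj₂ (inj₁ x)
pattern right x = inj₂ (inj₂ x)
pattern exit = inj₁ tt

Vertex : StExp A → Set
Vertex 𝟎       = ⊤
Vertex 𝟏       = ⊤
Vertex (act _) = ⊤
Vertex (e + f) = ⊤ ⊎ (Vertex e ⊎ Vertex f)
Vertex (e · f) = Vertex e ⊎ Vertex f
Vertex (e *)   = ⊤ ⊎ Vertex e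

Finite : Set → Set
Finite V = ∃[ n ] (V ↔ Fin n)

⊤-finite : Finite ⊤
⊤-finite = 1 , ↔-sym 1↔⊤

⊎-finite : ∀ {V W} → Finite V → Finite W → Finite (V ⊎ W)
⊎-finite (m , V↔) (n , W↔) = m ℕ.+ n , ↔-sym +↔⊎ ↔-∘ (V↔ ⊎-↔ W↔)

vertex-finite : (e : StExp A) → Finite (Vertex e)
vertex-finite 𝟎       = ⊤-finite
vertex-finite 𝟏       = ⊤-finite
vertex-finite (act _) = ⊤-finite
vertex-finite (e + f) = ⊎-finite ⊤-finite (⊎-finite (vertex-finite e) (vertex-finite f))
vertex-finite (e · f) = ⊎-finite (vertex-finite e) (vertex-finite f)
vertex-finite (e *)   = ⊎-finite ⊤-finite (vertex-finite e)

first : (e : StExp A) → Vertex e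
first 𝟎       = tt
first 𝟏       = tt
first (act _) = tt
first (e + f) = top
first (e · f) = inj₁ (first e)
first (e *)   = top

-- The chart of e is built inside a set W of vertices: ι embeds the vertices of e,
-- and k is the vertex reached when e terminates.  The only entry transitions are
-- those that lead from a star into its body.
entries : (e : StExp A) → (Vertex e → W) → Vertex e → List (Label A × W)
entries 𝟎       ι _         = []
entries 𝟏       ι _         = []
entries (act _) ι _         = []
entries (e + f) ι top       = []
entries (e + f) ι (left x)  = entries e (ι ∘ inj₂ ∘ inj₁) x
entries (e + f) ι (right x) = entries f (ι ∘ inj₂ ∘ inj₂) x
entries (e · f) ι (inj₁ x)  = entries e (ι ∘ inj₁) x
entries (e · f) ι (inj₂ x)  = entries f (ι ∘ inj₂) x
entries (e *)   ι top       = (nothing , ι (inj₂ (first e))) ∷ []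
entries (e *)   ι (inj₂ x)  = entries e (ι ∘ inj₂) x

bodies : (e : StExp A) → (Vertex e → W) → W → Vertex e → List (Label A × W)
bodies 𝟎       ι k _         = []
bodies 𝟏       ι k _         = (nothing , k) ∷ []
bodies (act x) ι k _         = (just x , k) ∷ []
bodies (e + f) ι k top       = (nothing , ι (left (first e))) ∷ (nothing , ι (right (first f))) ∷ []
bodies (e + f) ι k (left x)  = bodies e (ι ∘ inj₂ ∘ inj₁) k x
bodies (e + f) ι k (right x) = bodies f (ι ∘ inj₂ ∘ inj₂) k x
bodies (e · f) ι k (inj₁ x)  = bodies e (ι ∘ inj₁) (ι (inj₂ (first f))) x
bodies (e · f) ι k (inj₂ x)  = bodies f (ι ∘ inj₂) k x
bodies (e *)   ι k top       = (nothing , k) ∷ []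
bodies (e *)   ι k (inj₂ x)  = bodies e (ι ∘ inj₂) (ι top) x

transitions : (e : StExp A) → (Vertex e → W) → W → Vertex e → List (Label A × W)
transitions e ι k x = entries e ι x ++ bodies e ι k x

-- Only the two 1-transitions of a sum or of a star could coincide: injectivity of `ι` separates the
-- former, freshness of the exit the latter.
transitions-unique : ∀ (e : StExp A) (ι : Vertex e → W) {k} → (∀ {x y} → ι x ≡ ι y → x ≡ y) →
                     (∀ x → ι x ≢ k) → ∀ x → Unique (transitions e ι k x)
transitions-unique 𝟎       ι inj fresh _         = []
transitions-unique 𝟏       ι inj fresh _         = [] ∷ []
transitions-unique (act _) ι inj fresh _         = [] ∷ []
transitions-unique (e + f) ι inj fresh top       =
  ((λ eq → case inj (cong proj₂ eq) of λ ()) ∷ []) ∷ [] ∷ []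
transitions-unique (e + f) ι inj fresh (left x)  =
  transitions-unique e _ (inj₁-injective ∘ inj₂-injective ∘ inj) (fresh ∘ inj₂ ∘ inj₁) x
transitions-unique (e + f) ι inj fresh (right x) =
  transitions-unique f _ (inj₂-injective ∘ inj₂-injective ∘ inj) (fresh ∘ inj₂ ∘ inj₂) x
transitions-unique (e · f) ι inj fresh (inj₁ x)  =
  transitions-unique e _ (inj₁-injective ∘ inj) (λ _ eq → case inj eq of λ ()) x
transitions-unique (e · f) ι inj fresh (inj₂ x)  =
  transitions-unique f _ (inj₂-injective ∘ inj) (fresh ∘ inj₂) x
transitions-unique (e *)   ι inj fresh top       = (fresh _ ∘ cong proj₂ ∷ []) ∷ [] ∷ []
transitions-unique (e *)   ι inj fresh (inj₂ x)  =
  transitions-unique e _ (inj₂-injective ∘ inj) (λ _ eq → case inj eq of λ ()) x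

-- The vertices of the loops that start at v.
Region : (e : StExp A) → Vertex e → Vertex e → Set
Region (e + f) (left v)  (left x)  = Region e v x
Region (e + f) (right v) (right x) = Region f v x
Region (e · f) (inj₁ v)  (inj₁ x)  = Region e v x
Region (e · f) (inj₂ v)  (inj₂ x)  = Region f v x
Region (e *)   top       _         = ⊤
Region (e *)   (inj₂ v)  (inj₂ x)  = Region e v x
Region _       _         _         = ⊥

loops : (e : StExp A) → List (Vertex e)
loops 𝟎       = []
loops 𝟏       = []
loops (act _) = []
loops (e + f) = map (inj₂ ∘ inj₁) (loops e) ++ map (inj₂ ∘ inj₂) (loops f)
loops (e · f) = map inj₁ (loops e) ++ map inj₂ (loops f)
loops (e *)   = map inj₂ (loops e) ++ (top ∷ [])

transition-target : ∀ (e : StExp A) (ι : Vertex e → W) {k} x {l w} → (l , w) ∈ transitions e ι k x →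
                    (∃[ y ] w ≡ ι y) ⊎ w ≡ k
transition-target 𝟏       ι _ (here refl) = inj₂ refl
transition-target (act _) ι _ (here refl) = inj₂ refl
transition-target (e + f) ι top (here refl) = inj₁ (_ , refl)
transition-target (e + f) ι top (there (here refl)) = inj₁ (_ , refl)
transition-target (e + f) ι (left x) t =
  Sum.map₁ (λ (_ , eq) → _ , eq) (transition-target e _ x t)
transition-target (e + f) ι (right x) t =
  Sum.map₁ (λ (_ , eq) → _ , eq) (transition-target f _ x t)
transition-target (e · f) ι (inj₁ x) t =
  inj₁ (Sum.[ (λ (_ , eq) → _ , eq) , (λ eq → _ , eq) ]′ (transition-target e _ x t))
transition-target (e · f) ι (inj₂ x) t =
  Sum.map₁ (λ (_ , eq) → _ , eq) (transition-target f _ x t)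
transition-target (e *)   ι top (here refl) = inj₁ (_ , refl)
transition-target (e *)   ι top (there (here refl)) = inj₂ refl
transition-target (e *)   ι (inj₂ x) t =
  inj₁ (Sum.[ (λ (_ , eq) → _ , eq) , (λ eq → _ , eq) ]′ (transition-target e _ x t))

region-root : ∀ (e : StExp A) (ι : Vertex e → W) v {t} → t ∈ entries e ι v → Region e v v
region-root (e + f) ι (left v)  t = region-root e _ v t
region-root (e + f) ι (right v) t = region-root f _ v t
region-root (e · f) ι (inj₁ v)  t = region-root e _ v t
region-root (e · f) ι (inj₂ v)  t = region-root f _ v t
region-root (e *)   ι top       t = tt
region-root (e *)   ι (inj₂ v)  t = region-root e _ v t

region-entry : ∀ (e : StExp A) (ι : Vertex e → W) v {l w} → (l , w) ∈ entries e ι v →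
               ∃[ y ] w ≡ ι y × Region e v y
region-entry (e + f) ι (left v)  t = Product.map _ id (region-entry e _ v t)
region-entry (e + f) ι (right v) t = Product.map _ id (region-entry f _ v t)
region-entry (e · f) ι (inj₁ v)  t = Product.map _ id (region-entry e _ v t)
region-entry (e · f) ι (inj₂ v)  t = Product.map _ id (region-entry f _ v t)
region-entry (e *)   ι top       (here refl) = _ , refl , tt
region-entry (e *)   ι (inj₂ v)  t = Product.map _ id (region-entry e _ v t)

-- The exit of a star's body is the star vertex itself, so a region can be left only from its root.
region-step : ∀ (e : StExp A) (ι : Vertex e → W) {k} v x {l w} → Region e v x → x ≢ v →
              (l , w) ∈ transitions e ι k x → ∃[ y ] w ≡ ι y × Region e v y
region-step (e + f) ι (left v)  (left x)  r x≢v t =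
  Product.map _ id (region-step e _ v x r (x≢v ∘ cong _) t)
region-step (e + f) ι (right v) (right x) r x≢v t =
  Product.map _ id (region-step f _ v x r (x≢v ∘ cong _) t)
region-step (e · f) ι (inj₁ v)  (inj₁ x)  r x≢v t =
  Product.map _ id (region-step e _ v x r (x≢v ∘ cong _) t)
region-step (e · f) ι (inj₂ v)  (inj₂ x)  r x≢v t =
  Product.map _ id (region-step f _ v x r (x≢v ∘ cong _) t)
region-step (e *)   ι top       top       r x≢v t = contradiction refl x≢v
region-step (e *)   ι top       (inj₂ x)  r x≢v t =
  Sum.[ (λ (_ , eq) → _ , eq , tt) , (λ eq → _ , eq , tt) ]′ (transition-target e _ x t)
region-step (e *)   ι (inj₂ v)  (inj₂ x)  r x≢v t =
  Product.map _ id (region-step e _ v x r (x≢v ∘ cong _) t)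

loops-complete : ∀ (e : StExp A) (ι : Vertex e → W) v {t} → t ∈ entries e ι v → v ∈ loops e
loops-complete (e + f) ι (left v)  t = ∈-++⁺ˡ (∈-map⁺ _ (loops-complete e _ v t))
loops-complete (e + f) ι (right v) t = ∈-++⁺ʳ _ (∈-map⁺ _ (loops-complete f _ v t))
loops-complete (e · f) ι (inj₁ v)  t = ∈-++⁺ˡ (∈-map⁺ _ (loops-complete e _ v t))
loops-complete (e · f) ι (inj₂ v)  t = ∈-++⁺ʳ _ (∈-map⁺ _ (loops-complete f _ v t))
loops-complete (e *)   ι top       t = ∈-++⁺ʳ _ (here refl)
loops-complete (e *)   ι (inj₂ v)  t = ∈-++⁺ˡ (∈-map⁺ _ (loops-complete e _ v t))

-- Regions in different operands are disjoint, and the region of an inner loop omits the enclosing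
-- star vertex, which is listed last.
loops-sorted : (e : StExp A) → AllPairs (λ v u → ¬ Region e v u) (loops e)
loops-sorted 𝟎       = []
loops-sorted 𝟏       = []
loops-sorted (act _) = []
loops-sorted (e + f) = AllPairs.++⁺ (AllPairs.map⁺ (loops-sorted e)) (AllPairs.map⁺ (loops-sorted f))
  (All.map⁺ (All.universal (λ _ → All.map⁺ (All.universal (λ _ ()) _)) _))
loops-sorted (e · f) = AllPairs.++⁺ (AllPairs.map⁺ (loops-sorted e)) (AllPairs.map⁺ (loops-sorted f))
  (All.map⁺ (All.universal (λ _ → All.map⁺ (All.universal (λ _ ()) _)) _))
loops-sorted (e *)   = AllPairs.++⁺ (AllPairs.map⁺ (loops-sorted e)) ([] ∷ [])
  (All.map⁺ (All.universal (λ _ → (λ ()) ∷ []) _))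

module _ {_⟶_ : Rel W ℓ} where

  -- Liveness selects a way to the exit; stars are left at once, so no entry is taken.
  live-path : ∀ {e : StExp A} (ι : Vertex e → W) {k} → Live e →
              (∀ x {l w} → (l , w) ∈ bodies e ι k x → ι x ⟶ w) → Star _⟶_ (ι (first e)) k
  live-path ι 𝟏       b = b tt (here refl) ◅ ε
  live-path ι (act x) b = b tt (here refl) ◅ ε
  live-path ι (+₁ p)  b = b top (here refl) ◅ live-path _ p (b ∘ inj₂ ∘ inj₁)
  live-path ι (+₂ p)  b = b top (there (here refl)) ◅ live-path _ p (b ∘ inj₂ ∘ inj₂)
  live-path ι (p · q) b = live-path _ p (b ∘ inj₁) ◅◅ live-path _ q (b ∘ inj₂)
  live-path ι (e *)   b = b top (here refl) ◅ ε

  loop-path : ∀ {e : StExp A} (ι : Vertex e → W) {k} → Normal e →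
              (∀ x {l w} → (l , w) ∈ bodies e ι k x → ι x ⟶ w) →
              All (λ v → Σ[ t ∈ Label A × W ] t ∈ entries e ι v × Star _⟶_ (proj₂ t) (ι v)) (loops e)
  loop-path ι 𝟎       b = []
  loop-path ι 𝟏       b = []
  loop-path ι (act _) b = []
  loop-path ι (n + m) b =
    All.++⁺ (All.map⁺ (loop-path _ n (b ∘ inj₂ ∘ inj₁))) (All.map⁺ (loop-path _ m (b ∘ inj₂ ∘ inj₂)))
  loop-path ι (prod _ n m) b =
    All.++⁺ (All.map⁺ (loop-path _ n (b ∘ inj₁))) (All.map⁺ (loop-path _ m (b ∘ inj₂)))
  loop-path ι (iter l _ n) b =
    All.++⁺ (All.map⁺ (loop-path _ n (b ∘ inj₂))) ((_ , here refl , live-path _ l (b ∘ inj₂)) ∷ [])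

  -- Left factors are crossed by `live-path` without entries; a star is entered only when `v` lies
  -- in its body.
  reaching-path : ∀ {e : StExp A} (ι : Vertex e → W) {k} → Normal e → ∀ v →
    (∀ x {l w} → (l , w) ∈ bodies e ι k x → ι x ⟶ w) →
    (∀ x {l w} → (l , w) ∈ entries e ι x → Region e x v → ι x ⟶ w) →
    Star _⟶_ (ι (first e)) (ι v)
  reaching-path ι 𝟎       _ b s = ε
  reaching-path ι 𝟏       _ b s = ε
  reaching-path ι (act _) _ b s = ε
  reaching-path ι (n + m) top b s = ε
  reaching-path ι (n + m) (left v) b s =
    b top (here refl) ◅ reaching-path _ n v (b ∘ inj₂ ∘ inj₁) (s ∘ inj₂ ∘ inj₁)
  reaching-path ι (n + m) (right v) b s =
    b top (there (here refl)) ◅ reaching-path _ m v (b ∘ inj₂ ∘ inj₂) (s ∘ inj₂ ∘ inj₂)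
  reaching-path ι (prod l n m) (inj₁ v) b s = reaching-path _ n v (b ∘ inj₁) (s ∘ inj₁)
  reaching-path ι (prod l n m) (inj₂ v) b s =
    live-path _ l (b ∘ inj₁) ◅◅ reaching-path _ m v (b ∘ inj₂) (s ∘ inj₂)
  reaching-path ι (iter l _ n) top b s = ε
  reaching-path ι (iter l _ n) (inj₂ v) b s =
    s top (here refl) tt ◅ reaching-path _ n v (b ∘ inj₂) (s ∘ inj₂)

-- n is the rank of the exit.
rank : (e : StExp A) → ℕ → Vertex e → ℕ
rank 𝟎       n _         = suc n
rank 𝟏       n _         = suc n
rank (act _) n _         = suc n
rank (e + f) n top       = suc (rank e n (first e) ℕ.+ rank f n (first f))
rank (e + f) n (left x)  = rank e n x
rank (e + f) n (right x) = rank f n x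
rank (e · f) n (inj₁ x)  = rank e (rank f n (first f)) x
rank (e · f) n (inj₂ x)  = rank f n x
rank (e *)   n top       = suc n
-- The body ranks above the star vertex: its transitions back to that vertex are bodies, while the
-- entry is exempt.
rank (e *)   n (inj₂ x)  = rank e (suc n) x

rank-body : ∀ (e : StExp A) (ι : Vertex e → W) {k} (ρ : W → ℕ) {n} →
            (∀ y → ρ (ι y) ≡ rank e n y) → ρ k ≡ n →
            ∀ x {l w} → (l , w) ∈ bodies e ι k x → ρ w < ρ (ι x)
rank-body 𝟏       ι ρ ρι refl x (here refl) rewrite ρι x = ℕ.≤-refl
rank-body (act _) ι ρ ρι refl x (here refl) rewrite ρι x = ℕ.≤-refl
rank-body (e + f) ι ρ ρι ρk top (here refl)
  rewrite ρι (left (first e)) | ρι top = s≤s (ℕ.m≤m+n _ _)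
rank-body (e + f) ι ρ ρι ρk top (there (here refl))
  rewrite ρι (right (first f)) | ρι top = s≤s (ℕ.m≤n+m _ _)
rank-body (e + f) ι ρ ρι ρk (left x)  t = rank-body e _ ρ (ρι ∘ inj₂ ∘ inj₁) ρk x t
rank-body (e + f) ι ρ ρι ρk (right x) t = rank-body f _ ρ (ρι ∘ inj₂ ∘ inj₂) ρk x t
rank-body (e · f) ι ρ ρι ρk (inj₁ x)  t = rank-body e _ ρ (ρι ∘ inj₁) (ρι (inj₂ (first f))) x t
rank-body (e · f) ι ρ ρι ρk (inj₂ x)  t = rank-body f _ ρ (ρι ∘ inj₂) ρk x t
rank-body (e *)   ι ρ ρι refl top (here refl) rewrite ρι top = ℕ.≤-refl
rank-body (e *)   ι ρ ρι ρk (inj₂ x)  t = rank-body e _ ρ (ρι ∘ inj₂) (ρι top) x t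

-- A potential that decreases along 1-transitions, where n is its value at the exit.
-- The start of the body of a star does not see its exit (height-first), so that
-- its height may be taken with 0 for n.
height : (e : StExp A) → ℕ → Vertex e → ℕ
height 𝟎       n _         = 0
height 𝟏       n _         = suc n
height (act _) n _         = 0
height (e + f) n top       = suc (height e n (first e) ℕ.+ height f n (first f))
height (e + f) n (left x)  = height e n x
height (e + f) n (right x) = height f n x
height (e · f) n (inj₁ x)  = height e (height f n (first f)) x
height (e · f) n (inj₂ x)  = height f n x
height (e *)   n top       = suc (n ℕ.+ height e 0 (first e))
height (e *)   n (inj₂ x)  = height e (suc (n ℕ.+ height e 0 (first e))) x

-- No silent path leads from the first vertex to the exit. In a product one of the two factors fails
-- to terminate, and it shields the exit.
height-first : ∀ {e : StExp A} → ¬ e ↓ → ∀ m n → height e m (first e) ≡ height e n (first e)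
height-first {e = 𝟎}     ¬↓ m n = refl
height-first {e = 𝟏}     ¬↓ m n = contradiction 𝟏↓ ¬↓
height-first {e = act _} ¬↓ m n = refl
height-first {e = e + f} ¬↓ m n =
  cong suc (cong₂ ℕ._+_ (height-first (¬↓ ∘ +↓₁) m n) (height-first (¬↓ ∘ +↓₂) m n))
height-first {e = e · f} ¬↓ m n with e ↓?
... | yes e↓ = cong (λ i → height e i (first e)) (height-first {e = f} (¬↓ ∘ ·↓ e↓) m n)
... | no ¬e↓ = height-first ¬e↓ _ _
height-first {e = e *}   ¬↓ m n = contradiction *↓ ¬↓

height-silent : ∀ {e : StExp A} (ι : Vertex e → W) {k} (ρ : W → ℕ) {n} → Normal e →
                (∀ y → ρ (ι y) ≡ height e n y) → ρ k ≡ n →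
                ∀ x {w} → (nothing , w) ∈ transitions e ι k x → ρ w < ρ (ι x)
height-silent ι ρ 𝟏 ρι refl x (here refl) rewrite ρι x = ℕ.≤-refl
height-silent ι ρ (act _) ρι ρk x (here ())
height-silent ι ρ (_+_ {e} {f} _ _) ρι ρk top (here refl)
  rewrite ρι (left (first e)) | ρι top = s≤s (ℕ.m≤m+n _ _)
height-silent ι ρ (_+_ {e} {f} _ _) ρι ρk top (there (here refl))
  rewrite ρι (right (first f)) | ρι top = s≤s (ℕ.m≤n+m _ _)
height-silent ι ρ (p + q) ρι ρk (left x) t = height-silent _ ρ p (ρι ∘ inj₂ ∘ inj₁) ρk x t
height-silent ι ρ (p + q) ρι ρk (right x) t = height-silent _ ρ q (ρι ∘ inj₂ ∘ inj₂) ρk x t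
height-silent ι ρ (prod {f = f} _ p q) ρι ρk (inj₁ x) t =
  height-silent _ ρ p (ρι ∘ inj₁) (ρι (inj₂ (first f))) x t
height-silent ι ρ (prod _ p q) ρι ρk (inj₂ x) t = height-silent _ ρ q (ρι ∘ inj₂) ρk x t
-- As the body is guarded, its first vertex keeps the height computed with 0 at the exit, which is
-- below that of the star vertex.
height-silent ι ρ {n} (iter {e} _ ¬e↓ _) ρι ρk top (here refl)
  rewrite ρι (inj₂ (first e)) | ρι top
        | height-first ¬e↓ (suc (n ℕ.+ height e 0 (first e))) 0 = s≤s (ℕ.m≤n+m _ n)
height-silent ι ρ (iter _ _ _) ρι refl top (there (here refl))
  rewrite ρι top = s≤s (ℕ.m≤m+n _ _)
height-silent ι ρ (iter _ _ p) ρι ρk (inj₂ x) t = height-silent _ ρ p (ρι ∘ inj₂) (ρι top) x t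

chart : StExp A → OneChart A
chart e = record
  { V          = ⊤ ⊎ Vertex e
  ; V-finite   = ⊎-finite ⊤-finite (vertex-finite e)
  ; start      = inj₂ (first e)
  ; out        = λ { exit → [] ; (inj₂ x) → transitions e inj₂ exit x }
  ; out-unique = λ { exit → [] ; (inj₂ x) → transitions-unique e inj₂ inj₂-injective (λ _ ()) x }
  ; terminates = λ { exit → true ; (inj₂ _) → false }
  }

-- Weak guardedness and LLEE for charts of normal expressions

module _ {A : Set a} {e : StExp A} (normal : Normal e) where

  chart-weaklyGuarded : WeaklyGuarded (chart e)
  chart-weaklyGuarded v c = ℕ.<-irrefl refl (descent c)
    where
    ρ : ⊤ ⊎ Vertex e → ℕ
    ρ exit     = 0
    ρ (inj₂ x) = height e 0 x

    silent : ∀ x {y} → Silent (chart e) x y → ρ y < ρ x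
    silent (inj₂ x) t = height-silent inj₂ ρ normal (λ _ → refl) refl x t

    descent : ∀ {x y} → TransClosure (Silent (chart e)) x y → ρ y < ρ x
    descent {x} [ t ]⁺   = silent x t
    descent {x} (t ∷ c)  = ℕ.<-trans (descent c) (silent x t)

  chart-LLEE : LLEE (chart e)
  chart-LLEE = Layering.witness⇒LLEE (chart e) record
    { entries = λ { exit → [] ; (inj₂ x) → entries e inj₂ x }
    ; bodies  = λ { exit → [] ; (inj₂ x) → bodies e inj₂ exit x }
    ; out≡    = λ { exit → refl ; (inj₂ _) → refl }
    ; rank    = ρ
    ; rank-body = λ { {inj₂ x} t → rank-body e inj₂ ρ (λ _ → refl) refl x t }
    ; Region = Reg
    ; region-root = λ { {inj₂ v} t → region-root e inj₂ v t }
    ; region-entry = λ { {inj₂ v} t → inRegion (region-entry e inj₂ v t) }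
    ; region-step = λ { {inj₂ v} {inj₂ x} r x≢v t →
                        inRegion (region-step e inj₂ v x r (x≢v ∘ cong inj₂) t) }
    ; region-nonterminating = λ { {inj₂ _} {inj₂ _} _ () }
    ; loops = map inj₂ (loops e)
    ; loops-complete = λ { {inj₂ v} t → ∈-map⁺ inj₂ (loops-complete e inj₂ v t) }
    ; loops-sorted = AllPairs.map⁺ (loops-sorted e)
    ; back = All.map⁺ (loop-path inj₂ normal (λ _ t → _ , t))
    ; forth = λ { {inj₂ v} _ →
        reaching-path inj₂ normal v (λ _ t → _ , inj₁ t) (λ _ t r → _ , inj₂ (t , r)) }
    }
    where
    ρ : ⊤ ⊎ Vertex e → ℕ
    ρ exit     = 0
    ρ (inj₂ x) = rank e 0 x

    Reg : ⊤ ⊎ Vertex e → ⊤ ⊎ Vertex e → Set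
    Reg (inj₂ v) (inj₂ x) = Region e v x
    Reg _        _        = ⊥

    inRegion : ∀ {v w} → ∃[ y ] w ≡ inj₂ y × Region e v y → Reg (inj₂ v) w
    inRegion (_ , refl , r) = r

-- Solutions of the charts

module Solutions {a ℓ} {A : Set a} {S : System A ℓ} (mil⁻ : ∀ {Γ q} → Mil⁻ A Γ q → S Γ q) where

  open NormalForm {S = S} mil⁻

  -- sol e g is the solution with value g at the exit.
  sol : (e : StExp A) → StExp A → Vertex e → StExp A
  sol 𝟎       g _         = 𝟎
  sol 𝟏       g _         = g
  sol (act x) g _         = act x · g
  sol (e + f) g top       = (e + f) · g
  sol (e + f) g (left x)  = sol e g x
  sol (e + f) g (right x) = sol f g x
  sol (e · f) g (inj₁ x)  = sol e (f · g) x
  sol (e · f) g (inj₂ x)  = sol f g x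
  sol (e *)   g top       = e * · g
  sol (e *)   g (inj₂ x)  = sol e (e * · g) x

  sol-first : ∀ e {g} → sol e g (first e) ≈ e · g
  sol-first 𝟎       = ≈-sym (ax 𝟎-·)
  sol-first 𝟏       = ≈-sym (ax 𝟏-·)
  sol-first (act x) = ≈-refl
  sol-first (e + f) = ≈-refl
  sol-first (e · f) = ≈-trans (sol-first e) (≈-sym (ax ·-assoc))
  sol-first (e *)   = ≈-refl

  *-step : ∀ e {g} → e * · g ≈ e · (e * · g) + g
  *-step e {g} = begin
    e * · g                  ≈⟨ ·-congʳ (ax *-unfold) ⟩
    (𝟏 + e · e *) · g        ≈⟨ ax ·-distʳ-+ ⟩
    𝟏 · g + (e · e *) · g    ≈⟨ +-cong (ax 𝟏-·) (ax ·-assoc) ⟩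
    g + e · (e * · g)        ≈⟨ ax +-comm ⟩
    e · (e * · g) + g        ∎

  -- Allowing any `s` provably equal to `sol` makes it possible to override values at single
  -- vertices.
  sol-transitions : ∀ e {g} (ι : Vertex e → W) {k} (s : W → StExp A) →
    (∀ x → s (ι x) ≈ sol e g x) → s k ≈ g →
    ∀ x → sol e g x ≈ ∑ (summands s (transitions e ι k x))
  sol-transitions 𝟎       ι s sι sk x   = ≈-refl
  sol-transitions 𝟏       ι s sι sk x   = ≈-trans (≈-sym sk) (≈-sym (ax 𝟏-·))
  sol-transitions (act y) ι s sι sk x   = ·-congˡ (≈-sym sk)
  sol-transitions (e + f) ι s sι sk top = ≈-trans (ax ·-distʳ-+) (≈-sym (+-cong
    (≈-trans (ax 𝟏-·) (≈-trans (sι (left (first e))) (sol-first e)))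
    (≈-trans (ax 𝟏-·) (≈-trans (sι (right (first f))) (sol-first f)))))
  sol-transitions (e + f) ι s sι sk (left x)  = sol-transitions e _ s (sι ∘ inj₂ ∘ inj₁) sk x
  sol-transitions (e + f) ι s sι sk (right x) = sol-transitions f _ s (sι ∘ inj₂ ∘ inj₂) sk x
  sol-transitions (e · f) ι s sι sk (inj₁ x)  =
    sol-transitions e _ s (sι ∘ inj₁) (≈-trans (sι (inj₂ (first f))) (sol-first f)) x
  sol-transitions (e · f) ι s sι sk (inj₂ x)  = sol-transitions f _ s (sι ∘ inj₂) sk x
  sol-transitions (e *)   ι s sι sk top       = ≈-trans (*-step e) (≈-sym (+-cong
    (≈-trans (ax 𝟏-·) (≈-trans (sι (inj₂ (first e))) (sol-first e)))
    (≈-trans (ax 𝟏-·) sk)))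
  sol-transitions (e *)   ι s sι sk (inj₂ x)  = sol-transitions e _ s (sι ∘ inj₂) (sι top) x

  module _ (p q X : StExp A) where

    -- The value at the start is literally `X`, since a coinductive proof requires syntactic
    -- equality there.
    +-solution : ⊤ ⊎ Vertex (p + q) → StExp A
    +-solution exit            = 𝟏
    +-solution (inj₂ top)      = X
    +-solution (inj₂ (inj₂ x)) = sol (p + q) 𝟏 (inj₂ x)

    +-isSolution : X ≈ p + q → IsSolution (chart (p + q)) S +-solution
    +-isSolution X≈ exit = ≈-sym (ax +-𝟎)
    +-isSolution X≈ (inj₂ x) = ≈-trans (agree x)
      (≈-trans (sol-transitions (p + q) inj₂ +-solution agree ≈-refl x) (≈-sym 𝟎-+))
      where
      agree : ∀ x → +-solution (inj₂ x) ≈ sol (p + q) 𝟏 x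
      agree top      = ≈-trans X≈ (≈-sym (ax ·-𝟏))
      agree (inj₂ _) = ≈-refl

    -- The star vertex is the start and the exit of `p`. With `X` there, the only condition left is
    -- `X ≈ p · X + q`.
    *·-solution : ⊤ ⊎ Vertex (p * · q) → StExp A
    *·-solution exit                   = 𝟏
    *·-solution (inj₂ (inj₁ top))      = X
    *·-solution (inj₂ (inj₁ (inj₂ x))) = sol p X x
    *·-solution (inj₂ (inj₂ x))        = sol q 𝟏 x

    *·-isSolution : X ≈ p · X + q → IsSolution (chart (p * · q)) S *·-solution
    *·-isSolution X≈ exit = ≈-sym (ax +-𝟎)
    *·-isSolution X≈ (inj₂ (inj₁ top)) = begin
      X
        ≈⟨ X≈ ⟩
      p · X + q
        ≈⟨ +-cong (sol-first p) (≈-trans (sol-first q) (ax ·-𝟏)) ⟨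
      sol p X (first p) + sol q 𝟏 (first q)
        ≈⟨ +-cong (ax 𝟏-·) (ax 𝟏-·) ⟨
      𝟏 · sol p X (first p) + 𝟏 · sol q 𝟏 (first q)
        ≈⟨ 𝟎-+ ⟨
      𝟎 + (𝟏 · sol p X (first p) + 𝟏 · sol q 𝟏 (first q)) ∎
    *·-isSolution X≈ (inj₂ (inj₁ (inj₂ x))) = ≈-trans
      (sol-transitions p (inj₂ ∘ inj₁ ∘ inj₂) *·-solution (λ _ → ≈-refl) ≈-refl x) (≈-sym 𝟎-+)
    *·-isSolution X≈ (inj₂ (inj₂ x)) = ≈-trans
      (sol-transitions q (inj₂ ∘ inj₂) *·-solution (λ _ → ≈-refl) ≈-refl x) (≈-sym 𝟎-+)

  LLEEProof : Eq A → Set (Level.suc Level.zero ⊔ a ⊔ ℓ)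
  LLEEProof q = Σ[ P ∈ CoinductiveProof S q ] LLEEWitnessed P

  -- Both sides are provably equal to `normalize e`, so either may stand at the start of its chart.
  coinductiveProof : ∀ {e f} → e ≈ f → LLEEProof (e ≐ f)
  coinductiveProof {e} {f} e≈f = record
    { chart         = chart (normalize e)
    ; weaklyGuarded = chart-weaklyGuarded (normalize-normal e)
    ; L             = λ v → +-solution (constant e) (positive e) e v ≐
                            +-solution (constant e) (positive e) f v
    ; solution₁     = +-isSolution (constant e) (positive e) e (≈-sym (normalize≈ e))
    ; solution₂     = +-isSolution (constant e) (positive e) f
                        (≈-trans (≈-sym e≈f) (≈-sym (normalize≈ e)))
    ; lhs≡          = refl
    ; rhs≡          = refl
    } , chart-LLEE (normalize-normal e)

  -- Both `e` and `f * · g` solve `X ≈ p · X + q`, hence both label the star vertex of the same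
  -- chart.
  rsp*-coinductiveProof : ∀ {e f g} → ¬ f ↓ → e ≈ f · e + g → LLEEProof (e ≐ f * · g)
  rsp*-coinductiveProof {e} {f} {g} ¬f↓ e≈ = byLiveness (live? p)
    where
    p = positive f
    q = normalize g

    solves : ∀ {X} → X ≈ f · X + g → X ≈ p · X + q
    solves X≈ = ≈-trans X≈ (+-cong (·-congʳ (≈-sym (positive≈ ¬f↓))) (≈-sym (normalize≈ g)))

    byLiveness : Dec (Live p) → LLEEProof (e ≐ f * · g)
    -- With `p` dead the star vertex would start no loop; but then `p · X ≈ p`, and both sides equal
    -- `p + q`.
    byLiveness (no ¬l) =
      coinductiveProof (≈-trans (value (solves e≈)) (≈-sym (value (solves (*-step f)))))
      where
      value : ∀ {X} → X ≈ p · X + q → X ≈ p + q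
      value X≈ = ≈-trans X≈ (+-congʳ (dead-· p ¬l))
    byLiveness (yes l) = record
      { chart         = chart (p * · q)
      ; weaklyGuarded = chart-weaklyGuarded normal
      ; L             = λ v → *·-solution p q e v ≐ *·-solution p q (f * · g) v
      ; solution₁     = *·-isSolution p q e (solves e≈)
      ; solution₂     = *·-isSolution p q (f * · g) (solves (*-step f))
      ; lhs≡          = refl
      ; rhs≡          = refl
      } , chart-LLEE normal
      where
      normal : Normal (p * · q)
      normal = prod (p *) (iter l (positive-¬↓ f) (positive-normal f)) (normalize-normal g)

-- Simulations between the systems

module _ {A : Set a} where

  assumption : {Γ : List (Eq A)} → All (Mil⁻+ (_∈ Γ) ⊢_) Γ
  assumption = All.tabulate λ q∈ → by (inj₂ (axiom q∈)) []

  rsp*⇒LCoProof : ∀ {Γ q} → RSP* A Γ q → LCoProof A 1 Γ q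
  rsp*⇒LCoProof (rsp* ¬f↓) =
    refl , Solutions.rsp*-coinductiveProof inj₁ ¬f↓ (by (inj₂ (axiom (here refl))) [])

  -- A rule instance of `Mil⁻ A` derives its conclusion from its premises taken as axioms, so one
  -- coinductive proof over these premises replaces it.
  rule⇒CLC : ∀ {Γ q} → Mil A Γ q → CLC A Γ q
  rule⇒CLC {q = _ ≐ _} (inj₁ r) =
    _ , refl , Solutions.coinductiveProof inj₁ (by (inj₁ r) assumption)
  rule⇒CLC (inj₂ r) = _ , rsp*⇒LCoProof r

  Mil⇒CLC : ∀ {q} → Mil A ⊢ q → CLC A ⊢ q
  Mil⇒CLC = translate (by ∘ rule⇒CLC)

  Mil⇒cMil₁ : ∀ {q} → Mil A ⊢ q → cMil₁ A ⊢ q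
  Mil⇒cMil₁ = translate λ r → by (Sum.map₂ rsp*⇒LCoProof r)

  cMil₁⇒cMil : ∀ {q} → cMil₁ A ⊢ q → cMil A ⊢ q
  cMil₁⇒cMil = translate λ r → by (Sum.map₂ (_ ,_) r)

  CLC⇒cMil : ∀ {q} → CLC A ⊢ q → cMil A ⊢ q
  CLC⇒cMil = translate λ r → by (inj₂ r)

theorem6p5 : {a : Level} (A : Set a) →
    TheoremEquivalent (Mil A) (cMil₁ A) × TheoremEquivalent (Mil A) (cMil A) ×
    TheoremEquivalent (Mil A) (CLC A) × TheoremEquivalent (cMil₁ A) (cMil A) ×
    TheoremEquivalent (cMil₁ A) (CLC A) × TheoremEquivalent (cMil A) (CLC A)
theorem6p5 A =
  (λ _ _ → mk⇔ Mil⇒cMil₁ (cMil⇒Mil ∘ cMil₁⇒cMil)) ,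
  (λ _ _ → mk⇔ (cMil₁⇒cMil ∘ Mil⇒cMil₁) cMil⇒Mil) ,
  (λ _ _ → mk⇔ Mil⇒CLC (cMil⇒Mil ∘ CLC⇒cMil)) ,
  (λ _ _ → mk⇔ cMil₁⇒cMil (Mil⇒cMil₁ ∘ cMil⇒Mil)) ,
  (λ _ _ → mk⇔ (Mil⇒CLC ∘ cMil⇒Mil ∘ cMil₁⇒cMil) (Mil⇒cMil₁ ∘ cMil⇒Mil ∘ CLC⇒cMil)) ,
  (λ _ _ → mk⇔ (Mil⇒CLC ∘ cMil⇒Mil) CLC⇒cMil)
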